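{- Let $G$ be a finite simple triangulated graph. Then $G$ is $S$-perfect if and only if $G$ contains no odd sun as an induced subgraph.
   Context: A graph is triangulated (chordal) if it has no induced cycle of length at least $4$. A star is a tree with one vertex adjacent to all other vertices ($K_1$ and $K_2$ count as stars). An $\mathbb{S}$-cover of $G$ is a family of stars that are subgraphs of $G$ such that every vertex of $G$ lies in at least one of them; $\theta_S(G)$ is the minimum size of an $\mathbb{S}$-cover. A set $T\subseteq V(G)$ is $S$-independent if no two vertices of $T$ lie in a common star subgraph of $G$ (equivalently, any two vertices of $T$ are at distance at least $3$); $\alpha_S(G)$ is the maximum size of an $S$-independent set. $G$ is $S$-perfect if $\alpha_S(H)=\theta_S(H)$ for every induced subgraph $H$ of $G$. A vertex is simplicial if it belongs to exactly one maximal clique (i.e., its neighbourhood is a clique). $k$-sun: let $H$ be a graph with a Hamiltonian cycle $C=v_1v_2\dots v_kv_1$ ($k\ge 3$); add new vertices $u_1,\dots,u_k$, with $u_i$ adjacent exactly to $v_i$ and $v_{i+1}$ (indices mod $k$), so each $u_i$ is simplicial. The resulting graph is a $k$-sun; it is an odd sun if $k$ is odd. -}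

module Defs where

open import Data.Nat using (ℕ; zero; suc; _≤_; _≥_)
open import Data.Nat.Properties using (_<?_)
open import Data.Bool using (Bool; true; false)
open import Data.Fin using (Fin; toℕ; fromℕ<; zero; suc)
open import Data.Fin.Subset using (Subset; _∈_; _⊆_; ∣_∣)
open import Data.List using (List; length)
open import Data.List.Relation.Unary.Any using (Any)
open import Data.Product using (Σ; ∃; _×_; _,_)
open import Data.Sum using (_⊎_)
open import Relation.Nullary using (¬_; yes; no)
open import Relation.Binary.PropositionalEquality using (_≡_; _≢_)
open import Function.Definitions using (Injective)

record Graph (n : ℕ) : Set where
  field
    adj    : Fin n → Fin n → Bool
    sym    : ∀ x y → adj x y ≡ adj y x
    irrefl : ∀ x → adj x x ≡ false

next : ∀ {m} → Fin (suc m) → Fin (suc m)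
next {m} i with suc (toℕ i) <? suc m
... | yes p = fromℕ< p
... | no _  = zero

data Odd : ℕ → Set where
  one : Odd 1
  ss  : ∀ {k} → Odd k → Odd (suc (suc k))

module _ {n : ℕ} (G : Graph n) where
  open Graph G

  Edge : Fin n → Fin n → Set
  Edge x y = adj x y ≡ true

  NonEdge : Fin n → Fin n → Set
  NonEdge x y = adj x y ≡ false

  IsInducedCycle : (m : ℕ) → (Fin (suc m) → Fin n) → Set
  IsInducedCycle m c =
    Injective _≡_ _≡_ c ×
    (∀ i j → (Edge (c i) (c j) → (j ≡ next i ⊎ i ≡ next j)) ×
             ((j ≡ next i ⊎ i ≡ next j) → Edge (c i) (c j)))

  Triangulated : Set
  Triangulated = ∀ m (c : Fin (suc m) → Fin n) → suc m ≥ 4 → ¬ IsInducedCycle m c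

  -- Induced odd sun: k = suc m odd, k ≥ 3, vertices v_i, u_i (i : Fin k),
  -- all 2k distinct; v_i v_{i+1} edges (Hamiltonian cycle of the v's; other
  -- edges among the v's arbitrary); u_i adjacent to v_j iff j = i or j = i+1;
  -- the u's pairwise non-adjacent.  (Exactly "the subgraph of G induced on
  -- these 2k vertices is a k-sun".)
  IsInducedSun : (m : ℕ) → (v u : Fin (suc m) → Fin n) → Set
  IsInducedSun m v u =
    Injective _≡_ _≡_ v × Injective _≡_ _≡_ u × (∀ i j → v i ≢ u j) ×
    (∀ i → Edge (v i) (v (next i))) ×
    (∀ i j → (Edge (u i) (v j) → (j ≡ i ⊎ j ≡ next i)) ×
             ((j ≡ i ⊎ j ≡ next i) → Edge (u i) (v j))) ×
    (∀ i j → NonEdge (u i) (u j))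

  ContainsOddSun : Set
  ContainsOddSun = Σ ℕ λ m → Odd (suc m) × suc m ≥ 3 ×
    Σ (Fin (suc m) → Fin n) λ v → Σ (Fin (suc m) → Fin n) λ u → IsInducedSun m v u

  -- Stars in the induced subgraph H = G[U]: a centre c ∈ U together with a set
  -- of leaves L ⊆ U, each leaf adjacent to c  (L = ∅ gives K₁, |L| = 1 gives K₂).
  record Star (U : Subset n) : Set where
    field
      centre    : Fin n
      leaves    : Subset n
      centre∈U  : centre ∈ U
      leaves⊆U  : leaves ⊆ U
      leavesAdj : ∀ {x} → x ∈ leaves → Edge centre x

  InStar : ∀ {U} → Fin n → Star U → Set
  InStar x s = x ≡ Star.centre s ⊎ x ∈ Star.leaves s

  IsSCover : (U : Subset n) → List (Star U) → Set
  IsSCover U F = ∀ {x} → x ∈ U → Any (InStar x) F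

  ThetaS : Subset n → ℕ → Set
  ThetaS U k = (Σ (List (Star U)) λ F → IsSCover U F × length F ≡ k) ×
               (∀ F → IsSCover U F → k ≤ length F)

  IsSIndependent : (U : Subset n) → Subset n → Set
  IsSIndependent U T = T ⊆ U ×
    (∀ {x y} → x ∈ T → y ∈ T → x ≢ y → ¬ Σ (Star U) λ s → InStar x s × InStar y s)

  AlphaS : Subset n → ℕ → Set
  AlphaS U k = (Σ (Subset n) λ T → IsSIndependent U T × ∣ T ∣ ≡ k) ×
               (∀ T → IsSIndependent U T → ∣ T ∣ ≤ k)

  SPerfect : Set
  SPerfect = ∀ (U : Subset n) → Σ ℕ λ k → AlphaS U k × ThetaS U k

{-# OPTIONS --safe #-}
module Submission where

open import Defs
open import Data.Bool using (Bool; true; false; not; if_then_else_)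
open import Data.Bool.Properties using (¬-not; not-¬; not-involutive) renaming (_≟_ to _≟ᵇ_)
open import Data.Fin using (Fin; zero; suc; toℕ; fromℕ<)
open import Data.Fin.Properties
  using (toℕ<n; toℕ-injective; toℕ-fromℕ<; any?; all?; _≟_; pigeonhole)
open import Data.Fin.Subset
  using (Subset; _∈_; _∉_; _⊆_; ∣_∣; _-_; _─_; _∩_; _∪_; ∁; ⁅_⁆; ⊤; inside; outside; Nonempty)
open import Data.Fin.Subset.Properties
  using (_∈?_; nonempty?; p─q⊆p; x∈p∧x≢y⇒x∈p-y; x∈p⇒∣p-x∣<∣p∣; Empty-unique; ∣⊥∣≡0; ∣⊤∣≡n; p─⊥≡p
        ; x∈p∩q⁺; x∈p∪q⁺; x∈p∪q⁻; x∈p∧x∉q⇒x∈p─q; x∉p⇒x∈∁p; x∈⁅x⁆; x∈⁅y⁆⇒x≡y; ∣⁅x⁆∣≡1; ∈⊤; p∩q⊆p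
        ; p∩q⊆q)
open import Data.List using (List; []; _∷_; length; map)
open import Data.List.Properties using (length-map)
open import Data.List.Relation.Unary.Any using (Any; here; there)
import Data.List.Relation.Unary.Any as Any
import Data.List.Relation.Unary.Any.Properties as Anyₚ
open import Data.Nat using (ℕ; zero; suc; _+_; _*_; _%_; _≤_; _<_; z≤n; s≤s; _≤?_; _≥_)
open import Data.Nat.DivMod using (m%n<n; %-distribˡ-+; [m+n]%n≡m%n; m%n%n≡m%n; m<n⇒m%n≡m; n%n≡0)
open import Data.Nat.Induction using (<-wellFounded; Acc; acc)
open import Data.Nat.Properties
  using (≤-refl; ≤-trans; ≤-pred; ≤-antisym; ≤-reflexive; ≤-total; <-cmp; ≤-<-trans; <-≤-trans
        ; <⇒≤; <⇒≢; <⇒≱; <-irrefl; ≰⇒>; ≮⇒≥; _<?_; n≤1+n; n<1+n; m≤m+n; m≤n+m; m≤n⇒m≤1+n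
        ; m+n≤o⇒n≤o; m≤n⇒m<n∨m≡n; m≤n⇒∃[o]m+o≡n; suc-injective; +-comm; +-assoc; +-suc; +-mono-≤
        ; +-monoˡ-≤; *-identityʳ; *-monoˡ-≤; *-cancelʳ-<; *-cancelʳ-≤; +-commutativeSemigroup)
open import Algebra.Properties.CommutativeSemigroup +-commutativeSemigroup using (interchange)
open import Data.Product using (Σ; ∃; ∃₂; _×_; _,_; proj₁; proj₂)
open import Data.Sum using (_⊎_; inj₁; inj₂; swap)
open import Data.Vec using ([]; _∷_; here; there; tabulate; head)
open import Data.Vec.Properties using (lookup∘tabulate; []=⇒lookup; lookup⇒[]=)
open import Function using (_∘_)
open import Level using (0ℓ)
open import Relation.Binary.Definitions using (tri<; tri≈; tri>)
open import Relation.Binary.PropositionalEquality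
  using (_≡_; _≢_; refl; sym; trans; cong; subst; subst₂)
open import Relation.Nullary using (¬_; Dec; yes; no; contradiction; ¬?)
open import Relation.Nullary.Decidable
  using (does; _×-dec_; _⊎-dec_; _→-dec_; decidable-stable; dec-true)
open import Relation.Unary using (Decidable; Pred)

-- In an odd k-sun every closed neighbourhood contains at least two v's and at most two u's, so an
-- S-independent set has at most k/2 elements and a cover has at least k/2 stars; equality of the
-- two numbers forces k to be even.
--
-- Conversely, induct on the set A of vertices to be dominated, as in Lovász's proof of König's
-- theorem.  If two vertices e, f of A share a neighbour c, take optimal dominating sets S of A - e
-- and T of A - f, and 2-colour W = (S Δ T) ∪ {c} so that every vertex with two members of W in its
-- closed neighbourhood sees both colours; S ∩ T together with either colour class dominates A, and
-- the smaller one has size at most max(|S|, |T|).  The colouring exists because closed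
-- neighbourhoods form a balanced hypergraph (Berge): an odd cycle in the graph of pairs
-- N[v] ∩ W = {y, z} is an odd cycle submatrix of the closed neighbourhood matrix, and chordality
-- turns such a submatrix into an induced odd sun.

-- The cyclic successor

next-cases : ∀ {m} (i : Fin (suc m)) →
  (toℕ i < m × toℕ (next i) ≡ suc (toℕ i)) ⊎ (toℕ i ≡ m × toℕ (next i) ≡ 0)
next-cases {m} i with suc (toℕ i) <? suc m
... | yes p = inj₁ (≤-pred p , toℕ-fromℕ< p)
... | no ¬p = inj₂ (≤-antisym (≤-pred (toℕ<n i)) (≤-pred (≮⇒≥ ¬p)) , refl)

next-suc : ∀ {m} (i j : Fin (suc m)) → toℕ j ≡ suc (toℕ i) → j ≡ next i
next-suc i j e with next-cases i
... | inj₁ (_ , f) = toℕ-injective (trans e (sym f))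
... | inj₂ (f , _) = contradiction (subst (_< _) (trans e (cong suc f)) (toℕ<n j)) (<-irrefl refl)

next-last : ∀ {m} (i j : Fin (suc m)) → toℕ i ≡ m → toℕ j ≡ 0 → j ≡ next i
next-last i j e f with next-cases i
... | inj₁ (l , _) = contradiction l (<-irrefl e)
... | inj₂ (_ , g) = toℕ-injective (trans f (sym g))

-- Detours around a vertex of a chordal graph

module _ {n : ℕ} (G : Graph n) where
  open Graph G renaming (sym to adj-sym)

  Cl : Fin n → Fin n → Set
  Cl x y = x ≡ y ⊎ Edge G x y

  edge? : ∀ x y → Dec (Edge G x y)
  edge? x y = adj x y ≟ᵇ true

  cl? : ∀ x y → Dec (Cl x y)
  cl? x y = (x ≟ y) ⊎-dec edge? x y

  edge-sym : ∀ {x y} → Edge G x y → Edge G y x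
  edge-sym {x} {y} e = trans (adj-sym y x) e

  edge-irrefl : ∀ {x} → ¬ Edge G x x
  edge-irrefl {x} e with trans (sym e) (irrefl x)
  ... | ()

  cl-sym : ∀ {x y} → Cl x y → Cl y x
  cl-sym (inj₁ e) = inj₁ (sym e)
  cl-sym (inj₂ e) = inj₂ (edge-sym e)

  cl-edge : ∀ {x y} → x ≢ y → Cl x y → Edge G x y
  cl-edge ne (inj₁ e) = contradiction e ne
  cl-edge ne (inj₂ e) = e

  -- Natural indices and ordered pairs `i < j` let each chord be examined once and make the
  -- wrap-around from `m` to `0` an explicit case; `cycleBelow⇒inducedCycle` translates this to
  -- `next`.
  record CycleBelow (m : ℕ) (a : ℕ → Fin n) : Set where
    field
      distinct : ∀ {i j} → i < j → j ≤ m → a i ≢ a j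
      edge⇒    : ∀ {i j} → i < j → j ≤ m → Edge G (a i) (a j) → (j ≡ suc i ⊎ (i ≡ 0 × j ≡ m))
      step     : ∀ {i} → i < m → Edge G (a i) (a (suc i))
      close    : Edge G (a m) (a 0)

  cycleBelow⇒inducedCycle : ∀ {m a} → CycleBelow m a → IsInducedCycle G m (a ∘ toℕ)
  cycleBelow⇒inducedCycle {m} {a} C = inj , λ i j → to i j , from i j
    where
    open CycleBelow C
    inj : ∀ {i j : Fin (suc m)} → a (toℕ i) ≡ a (toℕ j) → i ≡ j
    inj {i} {j} e with <-cmp (toℕ i) (toℕ j)
    ... | tri< l _ _ = contradiction e (distinct l (≤-pred (toℕ<n j)))
    ... | tri≈ _ f _ = toℕ-injective f
    ... | tri> _ _ l = contradiction (sym e) (distinct l (≤-pred (toℕ<n i)))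
    ordered : ∀ (i j : Fin (suc m)) → toℕ i < toℕ j →
      Edge G (a (toℕ i)) (a (toℕ j)) → j ≡ next i ⊎ i ≡ next j
    ordered i j l e with edge⇒ l (≤-pred (toℕ<n j)) e
    ... | inj₁ f = inj₁ (next-suc i j f)
    ... | inj₂ (f , g) = inj₂ (next-last j i g f)
    to : ∀ (i j : Fin (suc m)) → Edge G (a (toℕ i)) (a (toℕ j)) → j ≡ next i ⊎ i ≡ next j
    to i j e with <-cmp (toℕ i) (toℕ j)
    ... | tri< l _ _ = ordered i j l e
    ... | tri≈ _ f _ = contradiction (subst (λ k → Edge G (a k) (a (toℕ j))) f e) edge-irrefl
    ... | tri> _ _ l with ordered j i l (edge-sym e)
    ...   | inj₁ f = inj₂ f
    ...   | inj₂ f = inj₁ f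
    toNext : ∀ (i : Fin (suc m)) → Edge G (a (toℕ i)) (a (toℕ (next i)))
    toNext i with next-cases i
    ... | inj₁ (l , f) = subst (λ k → Edge G (a (toℕ i)) (a k)) (sym f) (step l)
    ... | inj₂ (e , f) = subst₂ (λ k l → Edge G (a k) (a l)) (sym e) (sym f) close
    from : ∀ (i j : Fin (suc m)) → j ≡ next i ⊎ i ≡ next j → Edge G (a (toℕ i)) (a (toℕ j))
    from i _ (inj₁ refl) = toNext i
    from _ j (inj₂ refl) = edge-sym (toNext j)

  -- A walk between two non-adjacent neighbours of `x` whose interior stays outside the closed
  -- neighbourhood of `x`. Steps are closed adjacencies, so the walk may stall or repeat vertices,
  -- and users need not prove its terms distinct.
  record Detour (x : Fin n) (m : ℕ) (q : ℕ → Fin n) : Set where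
    field
      start : Edge G x (q 0)
      end   : Edge G x (q m)
      apart : ¬ Cl (q 0) (q m)
      step  : ∀ i → i < m → Cl (q i) (q (suc i))
      avoid : ∀ i → 0 < i → i < m → ¬ Cl x (q i)

  detour-long : ∀ {x m q} → Detour x m q → 2 ≤ m
  detour-long {m = 0}           D = contradiction (inj₁ refl) (Detour.apart D)
  detour-long {m = 1}           D = contradiction (Detour.step D 0 ≤-refl) (Detour.apart D)
  detour-long {m = suc (suc _)} D = s≤s (s≤s z≤n)

  splice : ℕ → ℕ → (ℕ → Fin n) → ℕ → Fin n
  splice i d q t with t ≤? i
  ... | yes _ = q t
  ... | no  _ = q (t + d)

  splice-≤ : ∀ {i t} d q → t ≤ i → splice i d q t ≡ q t
  splice-≤ {i} {t} d q l with t ≤? i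
  ... | yes _ = refl
  ... | no ¬l = contradiction l ¬l

  splice-> : ∀ {i t} d q → i < t → splice i d q t ≡ q (t + d)
  splice-> {i} {t} d q l with t ≤? i
  ... | yes l′ = contradiction (≤-<-trans l′ l) (<-irrefl refl)
  ... | no _ = refl

  -- The positions `suc i` to `i + d` are skipped. Both ends survive and interior terms remain
  -- interior, so the only new step is the one at `i`, which is the given chord.
  splice-detour : ∀ {x m q} i d r → suc i + r + d ≡ m → Cl (q i) (q (suc i + d)) →
    Detour x m q → Detour x (suc i + r) (splice i d q)
  splice-detour {x} {m} {q} i d r refl c D = record
    { start = subst (Edge G x) (sym q₀) start
    ; end   = subst (Edge G x) (sym qₘ) end
    ; apart = λ c → apart (subst₂ Cl q₀ qₘ c)
    ; step  = step′
    ; avoid = avoid′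
    }
    where
    open Detour D
    q′ = splice i d q
    q₀ : q′ 0 ≡ q 0
    q₀ = splice-≤ {i} d q z≤n
    qₘ : q′ (suc i + r) ≡ q m
    qₘ = splice-> d q (s≤s (m≤m+n i r))
    step′ : ∀ t → t < suc i + r → Cl (q′ t) (q′ (suc t))
    step′ t l with <-cmp t i
    ... | tri< t<i _ _ = subst₂ Cl (sym (splice-≤ d q (<⇒≤ t<i))) (sym (splice-≤ d q t<i))
                           (step t (<-≤-trans l (m≤m+n _ d)))
    ... | tri≈ _ refl _ = subst₂ Cl (sym (splice-≤ d q ≤-refl)) (sym (splice-> d q ≤-refl)) c
    ... | tri> _ _ i<t = subst₂ Cl (sym (splice-> d q i<t)) (sym (splice-> d q (m≤n⇒m≤1+n i<t)))
                           (step (t + d) (+-monoˡ-≤ d l))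
    avoid′ : ∀ t → 0 < t → t < suc i + r → ¬ Cl x (q′ t)
    avoid′ t 0<t l with t ≤? i
    ... | yes t≤i = avoid t 0<t (<-≤-trans l (m≤m+n _ d))
    ... | no  _   = avoid (t + d) (<-≤-trans 0<t (m≤m+n t d)) (+-monoˡ-≤ d l)

  -- A chordless detour closes up through x to an induced cycle of length at least 4.
  no-detour-acc : Triangulated G → ∀ {x m q} → Acc _<_ m → ¬ Detour x m q
  no-detour-acc tri {x} {m} {q} (acc rec) D
    -- Chords join positions at least two apart; with `Cl`, a repeated vertex counts as a chord too.
    with any? (λ (i : Fin m) → any? (λ (d : Fin m) →
           (suc (toℕ i) + suc (toℕ d) ≤? m) ×-dec cl? (q (toℕ i)) (q (suc (toℕ i) + suc (toℕ d)))))
  ... | yes (i , d , l , c) with m≤n⇒∃[o]m+o≡n l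
  ...   | r , e = no-detour-acc tri (rec shorter) (splice-detour (toℕ i) (suc (toℕ d)) r total c D)
    where
    total : suc (toℕ i) + r + suc (toℕ d) ≡ m
    total = trans (trans (+-assoc (suc (toℕ i)) r _)
              (trans (cong (suc (toℕ i) +_) (+-comm r _)) (sym (+-assoc (suc (toℕ i)) _ r)))) e
    shorter : suc (toℕ i) + r < m
    shorter = subst (suc (toℕ i) + r <_) (trans (sym (+-suc (suc (toℕ i) + r) (toℕ d))) total)
                (s≤s (m≤m+n _ (toℕ d)))
  no-detour-acc tri {x} {m} {q} (acc rec) D | no none =
    tri (suc m) _ long (cycleBelow⇒inducedCycle {suc m} {a} record
      { distinct = distinct ; edge⇒ = edge⇒ ; step = step′ ; close = edge-sym end })
    where
    open Detour D
    a : ℕ → Fin n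
    a zero    = x
    a (suc i) = q i
    chordless : ∀ {i j} → suc i < j → j ≤ m → ¬ Cl (q i) (q j)
    chordless {i} l l′ c with m≤n⇒∃[o]m+o≡n l
    ... | d , refl = none (fromℕ< i<m , fromℕ< d<m , subst (_≤ m) shape l′ ,
            subst₂ (λ s t → Cl (q s) (q t)) (sym (toℕ-fromℕ< i<m)) shape c)
      where
      i<m : i < m
      i<m = ≤-trans (≤-trans (n≤1+n _) (m≤m+n (suc (suc i)) d)) l′
      d<m : d < m
      d<m = ≤-trans (s≤s (m≤n+m d (suc i))) l′
      shape : suc (suc i) + d ≡ suc (toℕ (fromℕ< i<m)) + suc (toℕ (fromℕ< d<m))
      shape rewrite toℕ-fromℕ< i<m | toℕ-fromℕ< d<m = cong suc (sym (+-suc i d))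
    -- A stall at `i` turns the following step into a chord, or the preceding step if the stall is
    -- the last one; if it is the only step, the ends coincide.
    irredundant : ∀ {i} → suc i ≤ m → q i ≢ q (suc i)
    irredundant {i} l e with m≤n⇒m<n∨m≡n l
    ... | inj₁ l′ = chordless ≤-refl l′ (subst (λ y → Cl y (q (suc (suc i)))) (sym e) (step (suc i) l′))
    irredundant {zero}  l e | inj₂ refl = apart (inj₁ e)
    irredundant {suc i} l e | inj₂ refl = chordless ≤-refl l (subst (Cl (q i)) e (step i (<⇒≤ l)))
    long : suc (suc m) ≥ 4
    long = s≤s (s≤s (detour-long D))
    fromX : ∀ {j} → j ≤ m → Cl x (q j) → j ≡ 0 ⊎ j ≡ m
    fromX {zero}  l c = inj₁ refl
    fromX {suc j} l c with m≤n⇒m<n∨m≡n l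
    ... | inj₁ l′ = contradiction c (avoid (suc j) (s≤s z≤n) l′)
    ... | inj₂ e  = inj₂ e
    distinct : ∀ {i j} → i < j → j ≤ suc m → a i ≢ a j
    distinct {zero} {suc j} _ (s≤s l) e with fromX l (inj₁ e)
    ... | inj₁ refl = edge-irrefl (subst (Edge G x) (sym e) start)
    ... | inj₂ refl = edge-irrefl (subst (Edge G x) (sym e) end)
    distinct {suc i} {suc j} (s≤s i<j) (s≤s l) e with m≤n⇒m<n∨m≡n i<j
    ... | inj₁ l′   = chordless l′ l (inj₁ e)
    ... | inj₂ refl = irredundant l e
    edge⇒ : ∀ {i j} → i < j → j ≤ suc m → Edge G (a i) (a j) → j ≡ suc i ⊎ (i ≡ 0 × j ≡ suc m)
    edge⇒ {zero} {suc j} _ (s≤s l) e with fromX l (inj₂ e)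
    ... | inj₁ f = inj₁ (cong suc f)
    ... | inj₂ f = inj₂ (refl , cong suc f)
    edge⇒ {suc i} {suc j} (s≤s i<j) (s≤s l) e with m≤n⇒m<n∨m≡n i<j
    ... | inj₁ l′   = contradiction (inj₂ e) (chordless l′ l)
    ... | inj₂ refl = inj₁ refl
    step′ : ∀ {i} → i < suc m → Edge G (a i) (a (suc i))
    step′ {zero}  _ = start
    step′ {suc i} (s≤s l) = cl-edge (irredundant l) (step i l)

  no-detour : Triangulated G → ∀ {x m q} → ¬ Detour x m q
  no-detour tri {m = m} = no-detour-acc tri (<-wellFounded m)

-- Odd cycles of closed neighbourhoods and suns

-- Doubles are written `r * 2` because `suc r * 2` reduces to `suc (suc (r * 2))`, so indices
-- advance by computation.
data Halving : ℕ → Set where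
  even : ∀ r → Halving (r * 2)
  odd  : ∀ r → Halving (suc (r * 2))

halve : ∀ t → Halving t
halve zero = even 0
halve (suc t) with halve t
... | even r = odd r
... | odd r  = even (suc r)

double-gap : ∀ i r → (suc i + r) * 2 ≡ i * 2 + (2 + r * 2)
double-gap zero    r = refl
double-gap (suc i) r = cong (2 +_) (double-gap i r)

double-gap⁺ : ∀ i r → suc ((suc i + r) * 2) ≡ i * 2 + (3 + r * 2)
double-gap⁺ i r = trans (cong suc (double-gap i r)) (sym (+-suc (i * 2) (2 + r * 2)))

double-gap⁻ : ∀ i r → (suc i + suc r) * 2 ≡ suc (i * 2) + (3 + r * 2)
double-gap⁻ i r = trans (double-gap i (suc r)) (+-suc (i * 2) (3 + r * 2))

halve-≤ : ∀ {r s} → suc (r * 2) < 2 + s * 2 → r ≤ s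
halve-≤ (s≤s (s≤s l)) = *-cancelʳ-≤ _ _ 2 l

halve-< : ∀ {r s} → suc (r * 2) < suc (s * 2) → r < s
halve-< {r} {s} (s≤s l) = *-cancelʳ-< 2 r s l

module _ {n : ℕ} (G : Graph n) where
  open Graph G renaming (sym to adj-sym)

  -- With k = h + 3, this is a 2k-cycle that is induced in the bipartite graph pairing two copies of
  -- the vertex set along closed neighbourhoods; a t lies in the copy given by the parity of t.
  -- Nothing is assumed about terms of equal parity.
  record StrongCycle (h : ℕ) (a : ℕ → Fin n) : Set where
    field
      period : ∀ t → a (t + (6 + h * 2)) ≡ a t
      step   : ∀ t → Cl G (a t) (a (suc t))
      far    : ∀ t r → r ≤ h → ¬ Cl G (a t) (a (t + (3 + r * 2)))

  open StrongCycle

  shift : ∀ {h a} → StrongCycle h a → StrongCycle h (a ∘ suc)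
  shift C = record { period = period C ∘ suc ; step = step C ∘ suc ; far = far C ∘ suc }

  shiftBy : ∀ {h a} t → StrongCycle h a → StrongCycle h (a ∘ (t +_))
  shiftBy zero    C = C
  shiftBy (suc t) C = shiftBy t (shift C)

  -- A neighbour along the cycle of one of two equal terms would also be close to the other, against
  -- `far`. For terms two apart the neighbour is the predecessor of `a 0`, reached through the
  -- period; otherwise it is `a 1`.
  cycle-distinct₀ : ∀ {h a} → StrongCycle h a → ∀ r → r ≤ suc h → a 0 ≢ a (2 + r * 2)
  cycle-distinct₀ {h} {a} C zero _ e =
    far C 2 h ≤-refl (cl-sym G (subst (Cl G (a (5 + h * 2))) (trans (period C 0) e) (step C (5 + h * 2))))
  cycle-distinct₀ {h} {a} C (suc r) (s≤s l) e = far C 1 r l (cl-sym G (subst (λ y → Cl G y (a 1)) e (step C 0)))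

  cycle-distinct : ∀ {h a} → StrongCycle h a → ∀ t r → r ≤ suc h → a t ≢ a (t + (2 + r * 2))
  cycle-distinct C zero    = cycle-distinct₀ C
  cycle-distinct C (suc t) = cycle-distinct (shift C) t

  module _ (tri : Triangulated G) where

    -- If `a 0` and `a 1` coincide, the rest of the cycle is a detour around them: `far` at `a 0`
    -- keeps off the odd interior terms, `far` at `a 1` the even ones.
    proper₀ : ∀ {h a} → StrongCycle h a → a 0 ≢ a 1
    proper₀ {h} {a} C e = no-detour G tri {a 0} {3 + h * 2} {λ i → a (2 + i)} record
      { start = cl-edge G (cycle-distinct₀ C 0 z≤n) (subst (λ y → Cl G y (a 2)) (sym e) (step C 1))
      ; end   = cl-edge G (λ f → cycle-distinct₀ (shift C) (suc h) ≤-refl (trans (sym e) f))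
                  (cl-sym G (subst (Cl G (a (5 + h * 2))) (period C 0) (step C (5 + h * 2))))
      ; apart = far C 2 h ≤-refl
      ; step  = λ i _ → step C (2 + i)
      ; avoid = avoid
      }
      where
      avoid : ∀ i → 0 < i → i < 3 + h * 2 → ¬ Cl G (a 0) (a (2 + i))
      avoid (suc i) _ l with halve i
      ... | even r = far C 0 r (≤-pred (halve-< l))
      ... | odd r  = far C 1 r (halve-≤ (≤-pred l)) ∘ subst (λ y → Cl G y (a (4 + r * 2))) e

    proper : ∀ {h a} → StrongCycle h a → ∀ t → a t ≢ a (suc t)
    proper C zero    = proper₀ C
    proper C (suc t) = proper (shift C) t

    Isolated₀ : ℕ → (ℕ → Fin n) → Set
    Isolated₀ h a = ∀ r → r ≤ suc h → ¬ Edge G (a 0) (a (2 + r * 2))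

    -- Walk from a 1 to the first a (2 + r * 2) adjacent to a 0: unless r = 0, this is a detour.
    isolated₀ : ∀ {h a} → StrongCycle h a → ¬ Edge G (a 0) (a 2) → Isolated₀ h a
    isolated₀ {h} {a} C ne r = go r (<-wellFounded r)
      where
      go : ∀ r → Acc _<_ r → r ≤ suc h → ¬ Edge G (a 0) (a (2 + r * 2))
      go zero    _         _ e = ne e
      go (suc r) (acc rec) l e = no-detour G tri {a 0} {3 + r * 2} {λ i → a (1 + i)} record
        { start = cl-edge G (proper₀ C) (step C 0)
        ; end   = e
        ; apart = far C 1 r (≤-pred l)
        ; step  = λ i _ → step C (1 + i)
        ; avoid = avoid
        }
        where
        avoid : ∀ i → 0 < i → i < 3 + r * 2 → ¬ Cl G (a 0) (a (1 + i))
        avoid (suc i) _ l′ with halve i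
        ... | even s = λ c → go s (rec s<) s≤ (cl-edge G (cycle-distinct₀ C s s≤) c)
          where
          s< : s < suc r
          s< = halve-< l′
          s≤ : s ≤ suc h
          s≤ = ≤-trans (<⇒≤ s<) l
        ... | odd s = far C 0 s (≤-trans (halve-≤ (≤-pred l′)) (≤-pred l))

    -- The terms from `a 1` round to the predecessor of `a 0` would be a detour around the isolated
    -- `a 0`, unless the two ends are adjacent.
    previous-edge : ∀ {h a} → StrongCycle h a → Isolated₀ h a → Edge G (a (5 + h * 2)) (a 1)
    previous-edge {h} {a} C iso with cl? G (a 1) (a (5 + h * 2))
    ... | yes c = edge-sym G (cl-edge G (cycle-distinct₀ (shift C) (suc h) ≤-refl) c)
    ... | no ¬c = contradiction (record
      { start = cl-edge G (proper₀ C) (step C 0)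
      ; end   = edge-sym G (cl-edge G (proper C (5 + h * 2) ∘ (λ f → trans f (sym (period C 0))))
                  (subst (Cl G (a (5 + h * 2))) (period C 0) (step C (5 + h * 2))))
      ; apart = ¬c
      ; step  = λ i _ → step C (1 + i)
      ; avoid = avoid
      }) (no-detour G tri {a 0} {4 + h * 2} {λ i → a (1 + i)})
      where
      avoid : ∀ i → 0 < i → i < 4 + h * 2 → ¬ Cl G (a 0) (a (1 + i))
      avoid (suc i) _ l with halve i
      ... | even r = λ c → iso r (halve-≤ l) (cl-edge G (cycle-distinct₀ C r (halve-≤ l)) c)
      ... | odd r  = far C 0 r (≤-pred (halve-< (≤-pred l)))

    -- Without this edge `isolated₀` cuts `a 2` off from all even terms ahead of it, and the last of
    -- these is `a (6 + h * 2)`, which is `a 0`.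
    edge⇒edge₂ : ∀ {h a} → StrongCycle h a → Edge G (a 0) (a 2) → Edge G (a 2) (a 4)
    edge⇒edge₂ {h} {a} C e with edge? G (a 2) (a 4)
    ... | yes e′ = e′
    ... | no ¬e  = contradiction (edge-sym G (subst (λ y → Edge G y (a 2)) (sym (period C 0)) e))
                     (isolated₀ (shift (shift C)) ¬e (suc h) ≤-refl)

    even-edges : ∀ {h a} → StrongCycle h a → Edge G (a 0) (a 2) → ∀ i → Edge G (a (i * 2)) (a (2 + i * 2))
    even-edges C e zero    = e
    even-edges C e (suc i) = even-edges (shift (shift C)) (edge⇒edge₂ C e) i

    -- The detour a 3, a 4, a 6, …, a (6 + h * 2) = a 0 around a 1 uses the chords of even type.
    not-both : ∀ {h a} → StrongCycle h a → Edge G (a 0) (a 2) → ¬ Edge G (a 1) (a 3)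
    not-both {h} {a} C e e′ = no-detour G tri {a 1} {2 + h} {q} record
      { start = e′
      ; end   = subst (Edge G (a 1)) (sym (period C 0)) (edge-sym G (cl-edge G (proper₀ C) (step C 0)))
      ; apart = far C 3 h ≤-refl
      ; step  = λ { zero _ → step C 3 ; (suc i) _ → inj₂ (even-edges C e (2 + i)) }
      ; avoid = λ { (suc i) _ l → far C 1 i (≤-pred (≤-pred l)) }
      }
      where
      q : ℕ → Fin n
      q zero    = a 3
      q (suc i) = a (4 + i * 2)

    -- At `a 1`, `not-both` excludes the short chord and `isolated₀` then all longer ones;
    -- `edge⇒edge₂` carries the hypothesis two places on.
    odd-isolated : ∀ {h a} → StrongCycle h a → Edge G (a 0) (a 2) →
      ∀ i r → r ≤ suc h → ¬ Edge G (a (suc (i * 2))) (a (suc (i * 2) + (2 + r * 2)))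
    odd-isolated C e zero    = isolated₀ (shift C) (not-both C e)
    odd-isolated C e (suc i) = odd-isolated (shift (shift C)) (edge⇒edge₂ C e) i

    -- The even terms form the Hamiltonian cycle by `even-edges`, the odd terms are independent by
    -- `odd-isolated`, and `step` with `far` fixes the edges between the two classes.
    sun : ∀ {h a} → StrongCycle h a → Edge G (a 0) (a 2) →
      IsInducedSun G (2 + h) (λ i → a (toℕ i * 2)) (λ i → a (suc (toℕ i * 2)))
    sun {h} {a} C e =
      (λ {i} {j} → v-injective i j) , (λ {i} {j} → u-injective i j) , v≢u , v-edge ,
      (λ i j → cl⇒ i j ∘ inj₂ , ⇒edge i j) , u-nonEdge
      where
      v u : Fin (3 + h) → Fin n
      v i = a (toℕ i * 2)
      u i = a (suc (toℕ i * 2))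
      gap : ∀ (i j : Fin (3 + h)) → toℕ i < toℕ j → ∃ λ r → suc (toℕ i) + r ≡ toℕ j × r ≤ suc h
      gap i j l with m≤n⇒∃[o]m+o≡n l
      ... | r , f = r , f , m+n≤o⇒n≤o (toℕ i) (≤-pred (≤-pred (subst (_< 3 + h) (sym f) (toℕ<n j))))
      apart : ∀ t → (∀ i r → r ≤ suc h → a (t + i * 2) ≢ a (t + i * 2 + (2 + r * 2))) →
        ∀ (i j : Fin (3 + h)) → toℕ i < toℕ j → a (t + toℕ i * 2) ≢ a (t + toℕ j * 2)
      apart t d i j l f with gap i j l
      ... | r , g , l′ = d (toℕ i) r l′ (trans f (cong a (trans (cong (λ k → t + k * 2) (sym g))
                           (trans (cong (t +_) (double-gap (toℕ i) r)) (sym (+-assoc t (toℕ i * 2) _))))))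
      v-injective : ∀ i j → v i ≡ v j → i ≡ j
      v-injective i j f with <-cmp (toℕ i) (toℕ j)
      ... | tri< l _ _ = contradiction f (apart 0 (λ i → cycle-distinct C (i * 2)) i j l)
      ... | tri≈ _ g _ = toℕ-injective g
      ... | tri> _ _ l = contradiction (sym f) (apart 0 (λ i → cycle-distinct C (i * 2)) j i l)
      u-injective : ∀ i j → u i ≡ u j → i ≡ j
      u-injective i j f with <-cmp (toℕ i) (toℕ j)
      ... | tri< l _ _ = contradiction f (apart 1 (λ i → cycle-distinct C (suc (i * 2))) i j l)
      ... | tri≈ _ g _ = toℕ-injective g
      ... | tri> _ _ l = contradiction (sym f) (apart 1 (λ i → cycle-distinct C (suc (i * 2))) j i l)
      v-next : ∀ i → v (next i) ≡ a (2 + toℕ i * 2)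
      v-next i with next-cases i
      ... | inj₁ (_ , f) = cong (λ k → a (k * 2)) f
      ... | inj₂ (f , g) = trans (cong (λ k → a (k * 2)) g)
                             (trans (sym (period C 0)) (cong (λ k → a (2 + k * 2)) (sym f)))
      v-edge : ∀ i → Edge G (v i) (v (next i))
      v-edge i = subst (Edge G (v i)) (sym (v-next i)) (even-edges C e (toℕ i))
      -- `far` excludes all but three positions: equal indices, `j` just after `i`, and the largest
      -- backward gap, which forces `j` to be `0` and `i` to be last.
      cl⇒ : ∀ i j → Cl G (u i) (v j) → j ≡ i ⊎ j ≡ next i
      cl⇒ i j c with <-cmp (toℕ i) (toℕ j)
      ... | tri≈ _ g _ = inj₁ (toℕ-injective (sym g))
      ... | tri< l _ _ with gap i j l
      ...   | zero  , g , _  = inj₂ (next-suc i j (trans (sym g) (cong suc (+-comm (toℕ i) 0))))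
      ...   | suc r , g , l′ = contradiction
              (subst (λ k → Cl G (u i) (a k)) (trans (cong (_* 2) (sym g)) (double-gap⁻ (toℕ i) r)) c)
              (far C (suc (toℕ i * 2)) r (≤-pred l′))
      cl⇒ i j c | tri> _ _ l with gap j i l
      ... | r , g , l′ with m≤n⇒m<n∨m≡n l′
      ...   | inj₁ l″ = contradiction
              (cl-sym G (subst (λ k → Cl G (a k) (v j))
                (trans (cong (λ k → suc (k * 2)) (sym g)) (double-gap⁺ (toℕ j) r)) c))
              (far C (toℕ j * 2) r (≤-pred l″))
      ...   | inj₂ refl = inj₂ (next-last i j (trans (sym g) (cong (λ k → suc k + suc h) j≡0)) j≡0)
        where
        j≡0 : toℕ j ≡ 0
        j≡0 with toℕ j | ≤-pred (subst (_< 3 + h) (sym g) (toℕ<n i))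
        ... | zero  | _ = refl
        ... | suc k | s≤s l = contradiction (≤-<-trans (m≤n+m (suc h) k) l) (<-irrefl refl)
      ⇒edge : ∀ i j → j ≡ i ⊎ j ≡ next i → Edge G (u i) (v j)
      ⇒edge i _ (inj₁ refl) = edge-sym G (cl-edge G (proper C _) (step C (toℕ i * 2)))
      ⇒edge i _ (inj₂ refl) = subst (Edge G (u i)) (sym (v-next i)) (cl-edge G (proper C _) (step C (suc (toℕ i * 2))))
      -- Equality is a closed adjacency, so `cl⇒` and `⇒edge` turn it into an edge, which would be a
      -- loop.
      v≢u : ∀ i j → v i ≢ u j
      v≢u i j f = edge-irrefl G (subst (Edge G (u j)) f (⇒edge j i (cl⇒ j i (inj₁ (sym f)))))
      u-far : ∀ i j → toℕ i < toℕ j → ¬ Edge G (u i) (u j)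
      u-far i j l e′ with gap i j l
      ... | r , g , l′ = odd-isolated C e (toℕ i) r l′
              (subst (λ k → Edge G (u i) (a k))
                (trans (cong (λ k → suc (k * 2)) (sym g)) (cong suc (double-gap (toℕ i) r))) e′)
      u-nonEdge : ∀ i j → NonEdge G (u i) (u j)
      u-nonEdge i j with <-cmp (toℕ i) (toℕ j)
      ... | tri< l _ _ = ¬-not (u-far i j l)
      ... | tri≈ _ g _ rewrite toℕ-injective g = irrefl (u j)
      ... | tri> _ _ l = ¬-not (u-far j i l ∘ edge-sym G)

    -- Either `a 0` has the short chord to `a 2`, or it is isolated and its two neighbours on the
    -- cycle are adjacent. Then a shift by `5 + h * 2`, one place back round the cycle, exchanges
    -- the parity classes.
    strongCycle⇒sun : ∀ {h a} → StrongCycle h a →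
      Σ (Fin (3 + h) → Fin n) λ v → Σ (Fin (3 + h) → Fin n) λ u → IsInducedSun G (2 + h) v u
    strongCycle⇒sun {h} {a} C with edge? G (a 0) (a 2)
    ... | yes e = _ , _ , sun C e
    ... | no ¬e = _ , _ , sun (shiftBy (5 + h * 2) C)
      (subst₂ (λ y z → Edge G y z) (cong a (sym (+-comm (5 + h * 2) 0)))
        (sym (trans (cong a (+-comm (5 + h * 2) 2)) (period C 1))) (previous-edge C (isolated₀ C ¬e)))

-- Bicolouring

odd-parity : ∀ k → Odd k ⊎ Odd (suc k)
odd-parity 0 = inj₂ one
odd-parity 1 = inj₁ one
odd-parity (suc (suc k)) with odd-parity k
... | inj₁ o = inj₁ (ss o)
... | inj₂ o = inj₂ (ss o)

suc-% : ∀ i m → suc (i % suc m) % suc m ≡ suc i % suc m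
suc-% i m = trans (%-distribˡ-+ 1 (i % suc m) (suc m))
  (trans (cong (λ k → (1 % suc m + k) % suc m) (m%n%n≡m%n i (suc m))) (sym (%-distribˡ-+ 1 i (suc m))))

-- Adding `m` undoes a successor modulo `suc m`.
suc-%-injective : ∀ i j m → suc i % suc m ≡ suc j % suc m → i % suc m ≡ j % suc m
suc-%-injective i j m e = trans (sym (back i)) (trans (cong (λ k → (k + m % suc m) % suc m) e) (back j))
  where
  back : ∀ i → (suc i % suc m + m % suc m) % suc m ≡ i % suc m
  back i = trans (sym (%-distribˡ-+ (suc i) m (suc m)))
             (trans (cong (_% suc m) (sym (+-suc i m))) ([m+n]%n≡m%n i (suc m)))

%-distinct : ∀ m i s → 0 < s → s < suc m → i % suc m ≢ (i + s) % suc m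
%-distinct m zero    (suc s) _ l e with trans e (m<n⇒m%n≡m l)
... | ()
%-distinct m (suc i) s l l′ e = %-distinct m i s l l′ (suc-%-injective i (i + s) m e)

x∈p─q⇒x∉q : ∀ {n} (p q : Subset n) {x} → x ∈ p ─ q → x ∉ q
x∈p─q⇒x∉q (inside ∷ p) (outside ∷ q) here       ()
x∈p─q⇒x∉q (s ∷ p)      (t ∷ q)       (there x∈) (there x∈′) = x∈p─q⇒x∉q p q x∈ x∈′

x∈p-y⇒x≢y : ∀ {n} (p : Subset n) {x y} → x ∈ p - y → x ≢ y
x∈p-y⇒x≢y p {x} x∈ refl = x∈p─q⇒x∉q p ⁅ x ⁆ x∈ (x∈⁅x⁆ x)

module _ {A : Set} where

  -- The sequences trade places at every step, so a shifted interleaving is again one, and `rotate`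
  -- lets a single induction treat both parities.
  interleave : (ℕ → A) → (ℕ → A) → ℕ → A
  interleave w c zero    = w 0
  interleave w c (suc t) = interleave c (w ∘ suc) t

  interleave-even : ∀ w c i → interleave w c (i * 2) ≡ w i
  interleave-even w c zero    = refl
  interleave-even w c (suc i) = interleave-even (w ∘ suc) (c ∘ suc) i

module _ {n : ℕ} (G : Graph n) where

  -- A cycle submatrix of order `h + 3` of the closed neighbourhood matrix: within a period, `c i`
  -- is close to just `w i` and `w (suc i)`. The shape is symmetric in the two families.
  record Crown (h : ℕ) (w c : ℕ → Fin n) : Set where
    field
      w-period : ∀ i → w (i + (3 + h)) ≡ w i
      c-period : ∀ i → c (i + (3 + h)) ≡ c i
      near     : ∀ i → Cl G (w i) (c i)
      near′    : ∀ i → Cl G (c i) (w (suc i))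
      far      : ∀ i r → r ≤ h → ¬ Cl G (w i) (c (i + suc r))
      far′     : ∀ i r → r ≤ h → ¬ Cl G (c i) (w (suc (i + suc r)))

  open Crown

  rotate : ∀ {h w c} → Crown h w c → Crown h c (w ∘ suc)
  rotate C = record
    { w-period = c-period C ; c-period = w-period C ∘ suc
    ; near = near′ C ; near′ = near C ∘ suc ; far = far′ C ; far′ = far C ∘ suc }

  crown⇒strongCycle : ∀ {h w c} → Crown h w c → StrongCycle G h (interleave w c)
  crown⇒strongCycle C = record { period = period C ; step = step C ; far = far* C }
    where
    period : ∀ {h w c} → Crown h w c → ∀ t → interleave w c (t + (6 + h * 2)) ≡ interleave w c t
    period {h} {w} {c} C zero    = trans (interleave-even w c (3 + h)) (w-period C 0)
    period             C (suc t) = period (rotate C) t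
    step : ∀ {h w c} → Crown h w c → ∀ t → Cl G (interleave w c t) (interleave w c (suc t))
    step C zero    = near C 0
    step C (suc t) = step (rotate C) t
    far* : ∀ {h w c} → Crown h w c → ∀ t r → r ≤ h →
      ¬ Cl G (interleave w c t) (interleave w c (t + (3 + r * 2)))
    far* {w = w} {c} C zero r l = far C 0 r l ∘ subst (Cl G (w 0)) (interleave-even c (w ∘ suc) (suc r))
    far* C (suc t) = far* (rotate C) t

  Pair : Subset n → Fin n → Fin n → Fin n → Set
  Pair W v y z = Cl G v y × Cl G v z × (∀ w → w ∈ W → Cl G v w → w ≡ y ⊎ w ≡ z)

  pair? : ∀ W v y z → Dec (Pair W v y z)
  pair? W v y z = cl? G v y ×-dec cl? G v z ×-dec
    all? (λ w → (w ∈? W) →-dec (cl? G v w →-dec ((w ≟ y) ⊎-dec (w ≟ z))))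

  pair-sym : ∀ {W v y z} → Pair W v y z → Pair W v z y
  pair-sym (c , c′ , only) = c′ , c , λ w w∈W d → swap (only w w∈W d)

  module _ {W : Subset n} {h : ℕ} {p e : ℕ → Fin n}
           (distinct : ∀ {i j} → i < j → j ≤ 2 + h → p i ≢ p j)
           (member   : ∀ {i} → i ≤ 2 + h → p i ∈ W)
           (pair     : ∀ {i} → i ≤ 2 + h → Pair W (e i) (p i) (p (suc i % (3 + h)))) where

    private
      w c : ℕ → Fin n
      w i = p (i % (3 + h))
      c i = e (i % (3 + h))

      %≤ : ∀ i → i % (3 + h) ≤ 2 + h
      %≤ i = ≤-pred (m%n<n i (3 + h))

      w-distinct : ∀ i s → 0 < s → s < 3 + h → w i ≢ w (i + s)
      w-distinct i s l l′ f with <-cmp (i % (3 + h)) ((i + s) % (3 + h))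
      ... | tri< m _ _ = distinct m (%≤ (i + s)) f
      ... | tri≈ _ g _ = %-distinct (2 + h) i s l l′ g
      ... | tri> _ _ m = distinct m (%≤ i) (sym f)

      w-distinct⁺ : ∀ i s → suc s < 3 + h → w i ≢ w (suc (i + s))
      w-distinct⁺ i s l f = w-distinct i (suc s) (s≤s z≤n) l (trans f (cong w (sym (+-suc i s))))

      pair% : ∀ i → Pair W (c i) (w i) (w (suc i))
      pair% i = subst (λ k → Pair W (c i) (w i) (p k)) (suc-% i (2 + h)) (pair (%≤ i))

    -- Any further incidence would identify a term of `w` with one of the two members of a pair,
    -- whereas the terms within a period are distinct.
    pairCycle⇒crown : Crown h w c
    pairCycle⇒crown = record
      { w-period = λ i → cong p ([m+n]%n≡m%n i (3 + h))
      ; c-period = λ i → cong e ([m+n]%n≡m%n i (3 + h))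
      ; near  = λ i → cl-sym G (proj₁ (pair% i))
      ; near′ = λ i → proj₁ (proj₂ (pair% i))
      ; far   = far₁
      ; far′  = far₂
      }
      where
      far₁ : ∀ i r → r ≤ h → ¬ Cl G (w i) (c (i + suc r))
      far₁ i r l d with proj₂ (proj₂ (pair% (i + suc r))) (w i) (member (%≤ i)) (cl-sym G d)
      ... | inj₁ f = w-distinct i (suc r) (s≤s z≤n) (s≤s (s≤s (m≤n⇒m≤1+n l))) f
      ... | inj₂ f = w-distinct⁺ i (suc r) (s≤s (s≤s (s≤s l))) f
      far₂ : ∀ i r → r ≤ h → ¬ Cl G (c i) (w (suc (i + suc r)))
      far₂ i r l d with proj₂ (proj₂ (pair% i)) (w (suc (i + suc r))) (member (%≤ (suc (i + suc r)))) d
      ... | inj₁ f = w-distinct⁺ i (suc r) (s≤s (s≤s (s≤s l))) (sym f)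
      ... | inj₂ f = w-distinct (suc i) (suc r) (s≤s z≤n) (s≤s (s≤s (m≤n⇒m≤1+n l))) (sym f)

  record Path (W : Subset n) (l : ℕ) (p : ℕ → Fin n) : Set where
    field
      distinct : ∀ {i j} → i < j → j ≤ l → p i ≢ p j
      member   : ∀ {i} → i ≤ l → p i ∈ W
      link     : ∀ {i} → i < l → ∃ λ v → Pair W v (p i) (p (suc i))

  singleton : ∀ {W x} → x ∈ W → Path W 0 (λ _ → x)
  singleton x∈W = record { distinct = λ { (s≤s _) () } ; member = λ _ → x∈W ; link = λ () }

  -- Maximal at the end p 0 only, in the graph joining y and z when some N[v] ∩ W is {y, z}.
  MaximalPath : Subset n → ℕ → (ℕ → Fin n) → Set
  MaximalPath W l p = Path W l p ×
    (∀ y → y ∈ W → (∃ λ v → Pair W v (p 0) y) → ∃ λ (j : Fin (suc l)) → y ≡ p (toℕ j))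

  path-short : ∀ {W l p} → Path W l p → l < n
  path-short {l = l} {p} P with n ≤? l
  ... | no ¬l = ≰⇒> ¬l
  ... | yes n≤l with pigeonhole (s≤s n≤l) (λ i → p (toℕ {suc l} i))
  ...   | i , j , i<j , e = contradiction e (Path.distinct P i<j (≤-pred (toℕ<n j)))

  -- The path grows at its start; `k` bounds the extensions left, since a path of distinct vertices
  -- has `l < n`.
  maximalPath : ∀ {W l p} k → n ≤ l + k → Path W l p → ∃ λ l → ∃ λ p → MaximalPath W l p
  maximalPath {l = l} zero n≤l P =
    contradiction (path-short P) (λ l< → <-irrefl refl (<-≤-trans l< (subst (n ≤_) (+-comm l 0) n≤l)))
  maximalPath {W} {l} {p} (suc k) n≤ P
    with any? (λ y → (y ∈? W) ×-dec any? (λ v → pair? W v (p 0) y) ×-dec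
                     ¬? (any? (λ (j : Fin (suc l)) → y ≟ p (toℕ j))))
  ... | no none = l , p , P , λ y y∈W lk →
          decidable-stable (any? (λ j → y ≟ p (toℕ j))) (λ off → none (y , y∈W , lk , off))
  ... | yes (y , y∈W , (v , pr) , off) = maximalPath k (subst (n ≤_) (+-suc l k) n≤) record
          { distinct = distinct′ ; member = member′ ; link = link′ }
    where
    open Path P
    q : ℕ → Fin n
    q zero    = y
    q (suc i) = p i
    distinct′ : ∀ {i j} → i < j → j ≤ suc l → q i ≢ q j
    distinct′ {zero}  {suc j} _ j≤ e = off (fromℕ< j≤ , trans e (cong p (sym (toℕ-fromℕ< j≤))))
    distinct′ {suc i} {suc j} (s≤s i<j) (s≤s j≤) = distinct i<j j≤
    member′ : ∀ {i} → i ≤ suc l → q i ∈ W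
    member′ {zero}  _       = y∈W
    member′ {suc i} (s≤s m) = member m
    link′ : ∀ {i} → i < suc l → ∃ λ v → Pair W v (q i) (q (suc i))
    link′ {zero}  _       = v , pair-sym pr
    link′ {suc i} (s≤s m) = link m

  -- A proper 2-colouring of the hypergraph of the sets N[v] ∩ W, with those of fewer than two
  -- elements exempt.
  Bicoloured : Subset n → (Fin n → Bool) → Set
  Bicoloured W f = ∀ v y z → y ∈ W → z ∈ W → y ≢ z → Cl G v y → Cl G v z →
    ∀ b → ∃ λ x → x ∈ W × Cl G v x × f x ≡ b

  module _ (tri : Triangulated G) (no-sun : ¬ ContainsOddSun G) where

    -- The vertices p 0, …, p (2 + j) and the centres of the links are the w's and c's of a crown.
    no-odd-chord : ∀ {W l p} → Path W l p → ∀ j → Odd (suc (2 + j)) → 2 + j ≤ l →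
      ∀ v → ¬ Pair W v (p 0) (p (2 + j))
    no-odd-chord {W} {l} {p} P j o j≤l v pr =
      no-sun (2 + j , o , s≤s (s≤s (s≤s z≤n)) ,
        strongCycle⇒sun G tri (crown⇒strongCycle (pairCycle⇒crown {W} {j} {p} {e}
          (λ i<k k≤ → distinct i<k (≤-trans k≤ j≤l)) (λ i≤ → member (≤-trans i≤ j≤l)) pair)))
      where
      open Path P
      e : ℕ → Fin n
      -- The vertex `v` serves the closing pair, from `p (2 + j)` back to `p 0`.
      e i with i <? 2 + j
      ... | yes i< = proj₁ (link (<-≤-trans i< j≤l))
      ... | no _   = v
      pair : ∀ {i} → i ≤ 2 + j → Pair W (e i) (p i) (p (suc i % (3 + j)))
      pair {i} i≤ with i <? 2 + j
      ... | yes i< = subst (λ k → Pair W (proj₁ (link (<-≤-trans i< j≤l))) (p i) (p k))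
                       (sym (m<n⇒m%n≡m (s≤s i<))) (proj₂ (link (<-≤-trans i< j≤l)))
      ... | no i≮ with ≤-antisym i≤ (≮⇒≥ i≮)
      ...   | refl = subst (λ k → Pair W v (p (2 + j)) (p k)) (sym (n%n≡0 (3 + j))) (pair-sym pr)

    -- On a path of length 0 the value `p 1` is a default; this is harmless, as `p 0` then has no
    -- partner in a maximal path.
    recolour : (p : ℕ → Fin n) → (Fin n → Bool) → Fin n → Bool
    recolour p f v = if does (v ≟ p 0) then not (f (p 1)) else f v

    recolour-start : ∀ p f → recolour p f (p 0) ≡ not (f (p 1))
    recolour-start p f with p 0 ≟ p 0
    ... | yes _ = refl
    ... | no ne = contradiction refl ne

    recolour-other : ∀ p f {v} → v ≢ p 0 → recolour p f v ≡ f v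
    recolour-other p f {v} ne with v ≟ p 0
    ... | yes e = contradiction e ne
    ... | no _  = refl

    -- Since p 0 ends a maximal path, all its partners lie on the path, at odd positions, and the
    -- path from p 1 on alternates under f; so one colour at p 0 suits all pairs.  Sets N[v] ∩ W of
    -- three or more elements keep both colours after p 0 is added.
    recolour-bicoloured : ∀ {W l p f} → MaximalPath W l p →
      Bicoloured (W - p 0) f → Bicoloured W (recolour p f)
    recolour-bicoloured {W} {l} {p} {f} (P , maximal) good = good′
      where
      open Path P
      g : Fin n → Bool
      g = recolour p f
      remains : ∀ {y} → y ∈ W → y ≢ p 0 → y ∈ W - p 0
      remains = x∈p∧x≢y⇒x∈p-y
      -- The colour opposite to that of `p (suc i)` must occur on the link, and the only other
      -- member of `W` there is `p (suc (suc i))`.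
      alternate : ∀ i → suc i < l → f (p (suc (suc i))) ≡ not (f (p (suc i)))
      alternate i i<l with link i<l
      ... | v , c , c′ , only
        with good v _ _ (remains (member (<⇒≤ i<l)) (distinct (s≤s z≤n) (<⇒≤ i<l) ∘ sym))
                        (remains (member i<l) (distinct (s≤s z≤n) i<l ∘ sym))
                        (distinct ≤-refl i<l) c c′ (not (f (p (suc i))))
      ... | y , y∈ , d , e with only y (p─q⊆p W _ y∈) d
      ...   | inj₁ refl = contradiction e (not-¬ refl)
      ...   | inj₂ refl = e
      odd-position : ∀ j → Odd j → j ≤ l → f (p j) ≡ f (p 1)
      odd-position 1 _ _ = refl
      odd-position (suc (suc (suc i))) (ss o) j≤ =
        trans (alternate (suc i) j≤) (trans (cong not (alternate i (<⇒≤ j≤)))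
          (trans (not-involutive _) (odd-position (suc i) o (<⇒≤ (<⇒≤ j≤)))))
      partner : ∀ v z → z ∈ W → z ≢ p 0 → Pair W v (p 0) z → f z ≡ f (p 1)
      partner v z z∈W ne pr with maximal z z∈W (v , pr)
      ... | zero  , e = contradiction e ne
      ... | suc j , refl with odd-parity (suc (toℕ j))
      ...   | inj₁ o = odd-position (suc (toℕ j)) o (toℕ<n j)
      ...   | inj₂ o with toℕ j | toℕ<n j
      ...     | suc i | i< = contradiction pr (no-odd-chord P i o i< v)
      partner v z z∈W ne pr | suc j , refl | inj₂ (ss ()) | zero | _
      inherit : ∀ v y z → y ∈ W - p 0 → z ∈ W - p 0 → y ≢ z → Cl G v y → Cl G v z →
        ∀ b → ∃ λ x → x ∈ W × Cl G v x × g x ≡ b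
      inherit v y z y∈ z∈ ne c c′ b with good v y z y∈ z∈ ne c c′ b
      ... | x , x∈ , d , e = x , p─q⊆p W _ x∈ , d , trans (recolour-other p f (x∈p-y⇒x≢y W x∈)) e
      with-start : ∀ v z → z ∈ W → z ≢ p 0 → Cl G v (p 0) → Cl G v z →
        ∀ b → ∃ λ x → x ∈ W × Cl G v x × g x ≡ b
      with-start v z z∈W ne c c′ b
        with any? (λ w → (w ∈? (W - p 0)) ×-dec cl? G v w ×-dec ¬? (w ≟ z))
      ... | yes (w , w∈ , d , w≢z) = inherit v w z w∈ (remains z∈W ne) w≢z d c′ b
      -- Here `p 0` and `z` are the only members of `W` close to `v`: `z` has the colour of `p 1`,
      -- and `p 0` the opposite one.
      ... | no none with b ≟ᵇ f (p 1)
      ...   | yes refl = z , z∈W , c′ , trans (recolour-other p f ne) (partner v z z∈W ne (c , c′ , only))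
        where
        only : ∀ w → w ∈ W → Cl G v w → w ≡ p 0 ⊎ w ≡ z
        only w w∈W d with w ≟ p 0
        ... | yes e = inj₁ e
        ... | no e  = inj₂ (decidable-stable (w ≟ z) (λ w≢z → none (w , remains w∈W e , d , w≢z)))
      ...   | no b≢ = p 0 , member z≤n , c , trans (recolour-start p f) (sym (¬-not b≢))
      good′ : Bicoloured W g
      good′ v y z y∈W z∈W y≢z c c′ with y ≟ p 0 | z ≟ p 0
      ... | yes refl | yes refl = contradiction refl y≢z
      ... | yes refl | no z≢    = with-start v z z∈W z≢ c c′
      ... | no y≢    | yes refl = with-start v y y∈W y≢ c′ c
      ... | no y≢    | no z≢    = inherit v y z (remains y∈W y≢) (remains z∈W z≢) y≢z c c′

    -- Induction on the size of `W`: the vertex deleted, and coloured last, is the end of a maximal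
    -- path grown from any member.
    bicolouring : ∀ k W → ∣ W ∣ ≤ k → ∃ (Bicoloured W)
    bicolouring k W ≤k with nonempty? W
    ... | no empty = (λ _ → true) , λ v y _ y∈W → contradiction (y , y∈W) empty
    bicolouring zero W ≤k | yes (x , x∈W) = contradiction (<-≤-trans (x∈p⇒∣p-x∣<∣p∣ x∈W) ≤k) (λ ())
    bicolouring (suc k) W ≤k | yes (x₀ , x₀∈W)
      with maximalPath n (m≤n+m n 0) (singleton x₀∈W)
    ... | l , p , M with bicolouring k (W - p 0)
                             (≤-pred (<-≤-trans (x∈p⇒∣p-x∣<∣p∣ (Path.member (proj₁ M) z≤n)) ≤k))
    ...   | f , good = recolour p f , recolour-bicoloured M good

-- Further facts on the cyclic successor and parity

next-injective : ∀ {m} (i j : Fin (suc m)) → next i ≡ next j → i ≡ j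
next-injective i j e with next-cases i | next-cases j
... | inj₁ (_ , f) | inj₁ (_ , g) = toℕ-injective (suc-injective (trans (sym f) (trans (cong toℕ e) g)))
... | inj₂ (f , _) | inj₂ (g , _) = toℕ-injective (trans f (sym g))
... | inj₁ (_ , f) | inj₂ (_ , g) with trans (sym f) (trans (cong toℕ e) g)
...   | ()
next-injective i j e | inj₂ (_ , f) | inj₁ (_ , g) with trans (sym f) (trans (cong toℕ e) g)
... | ()

next-≢ : ∀ {m} (i : Fin (suc m)) → 0 < m → i ≢ next i
next-≢ i l e with next-cases i
... | inj₁ (_ , f) = <⇒≢ (n<1+n (toℕ i)) (trans (cong toℕ e) f)
... | inj₂ (f , g) = <⇒≢ l (trans (sym g) (trans (sym (cong toℕ e)) f))

¬odd-double : ∀ k → ¬ Odd (k * 2)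
¬odd-double (suc k) (ss o) = ¬odd-double k o

-- Counting in finite sets

module _ {n : ℕ} {P : Pred (Fin n) 0ℓ} (P? : Decidable P) where

  comprehension : Subset n
  comprehension = tabulate (does ∘ P?)

  ∈-comprehension⁺ : ∀ {x} → P x → x ∈ comprehension
  ∈-comprehension⁺ {x} p = lookup⇒[]= x _ (trans (lookup∘tabulate _ x) (dec-true (P? x) p))

  ∈-comprehension⁻ : ∀ {x} → x ∈ comprehension → P x
  ∈-comprehension⁻ {x} x∈ with P? x | trans (sym (lookup∘tabulate (does ∘ P?) x)) ([]=⇒lookup x∈)
  ... | yes p | _ = p

∣p∣≤1+∣p-x∣ : ∀ {n} (p : Subset n) x → ∣ p ∣ ≤ suc ∣ p - x ∣
∣p∣≤1+∣p-x∣ (inside  ∷ p) zero    = s≤s (≤-reflexive (cong ∣_∣ (sym (p─⊥≡p p))))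
∣p∣≤1+∣p-x∣ (outside ∷ p) zero    = m≤n⇒m≤1+n (≤-reflexive (cong ∣_∣ (sym (p─⊥≡p p))))
∣p∣≤1+∣p-x∣ (inside  ∷ p) (suc x) = s≤s (∣p∣≤1+∣p-x∣ p x)
∣p∣≤1+∣p-x∣ (outside ∷ p) (suc x) = ∣p∣≤1+∣p-x∣ p x

∣p∣≤∣p∩q∣+∣p─q∣ : ∀ {n} (p q : Subset n) → ∣ p ∣ ≤ ∣ p ∩ q ∣ + ∣ p ─ q ∣
∣p∣≤∣p∩q∣+∣p─q∣ [] [] = z≤n
∣p∣≤∣p∩q∣+∣p─q∣ (inside  ∷ p) (inside  ∷ q) = s≤s (∣p∣≤∣p∩q∣+∣p─q∣ p q)
∣p∣≤∣p∩q∣+∣p─q∣ (inside  ∷ p) (outside ∷ q) = subst (suc ∣ p ∣ ≤_) (sym (+-suc _ _)) (s≤s (∣p∣≤∣p∩q∣+∣p─q∣ p q))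
∣p∣≤∣p∩q∣+∣p─q∣ (outside ∷ p) (inside  ∷ q) = ∣p∣≤∣p∩q∣+∣p─q∣ p q
∣p∣≤∣p∩q∣+∣p─q∣ (outside ∷ p) (outside ∷ q) = ∣p∣≤∣p∩q∣+∣p─q∣ p q

∣empty∣≤0 : ∀ {n} (p : Subset n) → ¬ Nonempty p → ∣ p ∣ ≤ 0
∣empty∣≤0 {n} p e = ≤-reflexive (trans (cong ∣_∣ (Empty-unique e)) (∣⊥∣≡0 n))

∣p∣≤1 : ∀ {n} (p : Subset n) → (∀ {x y} → x ∈ p → y ∈ p → x ≡ y) → ∣ p ∣ ≤ 1
∣p∣≤1 p eq with nonempty? p
... | no e = ≤-trans (∣empty∣≤0 p e) z≤n
... | yes (x , x∈) = ≤-trans (∣p∣≤1+∣p-x∣ p x)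
        (s≤s (∣empty∣≤0 _ λ (y , y∈) → x∈p-y⇒x≢y p y∈ (eq (p─q⊆p p _ y∈) x∈)))

∣p∣≤2 : ∀ {n} (p : Subset n) →
  (∀ {x y z} → x ∈ p → y ∈ p → z ∈ p → x ≡ y ⊎ x ≡ z ⊎ y ≡ z) → ∣ p ∣ ≤ 2
∣p∣≤2 p eq with nonempty? p
... | no e = ≤-trans (∣empty∣≤0 p e) z≤n
... | yes (x , x∈) = ≤-trans (∣p∣≤1+∣p-x∣ p x) (s≤s (∣p∣≤1 (p - x) rest))
  where
  rest : ∀ {y z} → y ∈ p - x → z ∈ p - x → y ≡ z
  rest y∈ z∈ with eq x∈ (p─q⊆p p _ y∈) (p─q⊆p p _ z∈)
  ... | inj₁ e        = contradiction (sym e) (x∈p-y⇒x≢y p y∈)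
  ... | inj₂ (inj₁ e) = contradiction (sym e) (x∈p-y⇒x≢y p z∈)
  ... | inj₂ (inj₂ e) = e

module _ {m : ℕ} {B : Set} (R : Fin m → B → Set) (R? : ∀ i b → Dec (R i b)) (d : ℕ)
         (capacity : ∀ b P → (∀ {i} → i ∈ P → R i b) → ∣ P ∣ ≤ d) where

  cover-bound : ∀ F P → (∀ {i} → i ∈ P → Any (R i) F) → ∣ P ∣ ≤ length F * d
  cover-bound []      P cov = ∣empty∣≤0 P λ (i , i∈) → none (cov i∈)
    where
    none : ∀ {i} → ¬ Any (R i) []
    none ()
  cover-bound (b ∷ F) P cov = ≤-trans (∣p∣≤∣p∩q∣+∣p─q∣ P Q) (+-mono-≤
    (capacity b (P ∩ Q) (∈-comprehension⁻ (λ i → R? i b) ∘ p∩q⊆q P Q))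
    (cover-bound F (P ─ Q) λ i∈ → later (cov (p─q⊆p P Q i∈))
      (x∈p─q⇒x∉q P Q i∈ ∘ ∈-comprehension⁺ (λ i → R? i b))))
    where
    Q = comprehension (λ i → R? i b)
    later : ∀ {i} → Any (R i) (b ∷ F) → ¬ R i b → Any (R i) F
    later (here r)  ¬r = contradiction r ¬r
    later (there a) _  = a

module _ {m k : ℕ} (R : Fin m → Fin k → Set) where

  -- Each member of `T` claims two members of `Q` and no two claims overlap, so removing one member
  -- together with its claim preserves the hypotheses.
  packing-bound : ∀ s T Q → ∣ T ∣ ≤ s →
    (∀ {t} → t ∈ T → ∃₂ λ i j → i ≢ j × (R t i × i ∈ Q) × (R t j × j ∈ Q)) →
    (∀ {t t′ i} → t ∈ T → t′ ∈ T → R t i → R t′ i → t ≡ t′) → ∣ T ∣ * 2 ≤ ∣ Q ∣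
  packing-bound s T Q ≤s two disj with nonempty? T
  ... | no e = ≤-trans (*-monoˡ-≤ 2 (∣empty∣≤0 T e)) z≤n
  packing-bound zero T Q ≤s two disj | yes (t , t∈) = contradiction (<-≤-trans (x∈p⇒∣p-x∣<∣p∣ t∈) ≤s) (λ ())
  packing-bound (suc s) T Q ≤s two disj | yes (t , t∈) with two t∈
  ... | i , j , i≢j , (ri , i∈) , (rj , j∈) =
    ≤-trans (*-monoˡ-≤ 2 (∣p∣≤1+∣p-x∣ T t))
      (≤-trans (s≤s (s≤s (packing-bound s (T - t) (Q - i - j)
        (≤-pred (<-≤-trans (x∈p⇒∣p-x∣<∣p∣ t∈) ≤s)) two′
        (λ t₁∈ t₂∈ → disj (p─q⊆p T _ t₁∈) (p─q⊆p T _ t₂∈)))))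
      (≤-trans (s≤s (x∈p⇒∣p-x∣<∣p∣ (x∈p∧x≢y⇒x∈p-y j∈ (i≢j ∘ sym)))) (x∈p⇒∣p-x∣<∣p∣ i∈)))
    where
    kept : ∀ {t′ i′} → t′ ∈ T - t → R t′ i′ → i′ ∈ Q → i′ ∈ Q - i - j
    kept t′∈ r i′∈ = x∈p∧x≢y⇒x∈p-y (x∈p∧x≢y⇒x∈p-y i′∈ (λ { refl → clash r ri })) (λ { refl → clash r rj })
      where
      clash : ∀ {i} → R _ i → ¬ R t i
      clash r r′ = x∈p-y⇒x≢y T t′∈ (disj (p─q⊆p T _ t′∈) t∈ r r′)
    two′ : ∀ {t′} → t′ ∈ T - t →
      ∃₂ λ i′ j′ → i′ ≢ j′ × (R t′ i′ × i′ ∈ Q - i - j) × (R t′ j′ × j′ ∈ Q - i - j)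
    two′ t′∈ with two (p─q⊆p T _ t′∈)
    ... | i′ , j′ , ne , (r , i′∈) , (r′ , j′∈) = i′ , j′ , ne , (r , kept t′∈ r i′∈) , (r′ , kept t′∈ r′ j′∈)

-- Domination and packing

weight : Bool → ℕ
weight true  = 1
weight false = 0

∣∷∣ : ∀ {n} b (p : Subset n) → ∣ b ∷ p ∣ ≡ weight b + ∣ p ∣
∣∷∣ true  p = refl
∣∷∣ false p = refl

∣∷∣-mono : ∀ {n} a b c d e {p q r s t : Subset n} →
  weight a + weight b ≤ weight c + (weight d + weight e) →
  ∣ p ∣ + ∣ q ∣ ≤ ∣ r ∣ + (∣ s ∣ + ∣ t ∣) → ∣ a ∷ p ∣ + ∣ b ∷ q ∣ ≤ ∣ c ∷ r ∣ + (∣ d ∷ s ∣ + ∣ e ∷ t ∣)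
∣∷∣-mono a b c d e {p} {q} {r} {s} {t} l l′
  rewrite ∣∷∣ a p | ∣∷∣ b q | ∣∷∣ c r | ∣∷∣ d s | ∣∷∣ e t
        | interchange (weight a) (∣ p ∣) (weight b) (∣ q ∣)
        | interchange (weight d) (∣ s ∣) (weight e) (∣ t ∣)
        | interchange (weight c) ∣ r ∣ (weight d + weight e) (∣ s ∣ + ∣ t ∣) = +-mono-≤ l l′

contested : ∀ {n} → Subset n → Subset n → Subset n → Subset n
contested S T X = ((S ─ T) ∪ (T ─ S)) ∪ X

merge : ∀ {n} → Subset n → Subset n → Subset n → Subset n → Subset n
merge S T X C = (S ∩ T) ∪ (contested S T X ∩ C)

-- Defined through `merge` on vectors of length 1, so that it is by computation the head of any
-- longer merge.
mergeBit : Bool → Bool → Bool → Bool → Bool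
mergeBit s t x c = head (merge (s ∷ []) (t ∷ []) (x ∷ []) (c ∷ []))

-- A common element of both sets enters both merges and is counted twice on the right; any other
-- contested element enters exactly one merge and is counted at least once.
merge-bit : ∀ s t x c →
  weight (mergeBit s t x c) + weight (mergeBit s t x (not c)) ≤ weight s + (weight t + weight x)
merge-bit true  true  _     _     = s≤s (s≤s z≤n)
merge-bit true  false _     true  = s≤s z≤n
merge-bit true  false _     false = s≤s z≤n
merge-bit false true  _     true  = s≤s z≤n
merge-bit false true  _     false = s≤s z≤n
merge-bit false false true  true  = s≤s z≤n
merge-bit false false true  false = s≤s z≤n
merge-bit false false false _     = z≤n

merge-card : ∀ {n} (S T X C : Subset n) →
  ∣ merge S T X C ∣ + ∣ merge S T X (∁ C) ∣ ≤ ∣ S ∣ + (∣ T ∣ + ∣ X ∣)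
merge-card [] [] [] [] = z≤n
merge-card (s ∷ S) (t ∷ T) (x ∷ X) (c ∷ C) =
  ∣∷∣-mono (mergeBit s t x c) (mergeBit s t x (not c)) s t x
    {merge S T X C} {merge S T X (∁ C)} {S} {T} {X} (merge-bit s t x c) (merge-card S T X C)

-- Two numbers above `m` add up to at least `m + m + 2`. The spare 1 pays for the shared neighbour
-- added to the contested set.
smaller-half : ∀ {p q} m → p + q ≤ m + (m + 1) → p ≤ m ⊎ q ≤ m
smaller-half {p} {q} m l with p ≤? m | q ≤? m
... | yes p≤ | _ = inj₁ p≤
... | no _ | yes q≤ = inj₂ q≤
... | no p≰ | no q≰ = contradiction l (<⇒≱ (subst (_≤ p + q) shape (+-mono-≤ (≰⇒> p≰) (≰⇒> q≰))))
  where
  shape : suc m + suc m ≡ suc (m + (m + 1))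
  shape = cong (λ k → suc (m + k)) (+-comm 1 m)

-- Membership proofs travel along because a star needs its centre to lie in `U`.
elements : ∀ {n} (p : Subset n) → List (∃ (_∈ p))
elements []            = []
elements (inside  ∷ p) = (zero , here) ∷ map (λ (x , x∈) → suc x , there x∈) (elements p)
elements (outside ∷ p) = map (λ (x , x∈) → suc x , there x∈) (elements p)

length-elements : ∀ {n} (p : Subset n) → length (elements p) ≡ ∣ p ∣
length-elements []            = refl
length-elements (inside  ∷ p) = cong suc (trans (length-map _ (elements p)) (length-elements p))
length-elements (outside ∷ p) = trans (length-map _ (elements p)) (length-elements p)

∈-elements : ∀ {n} (p : Subset n) {x} → x ∈ p → Any (λ e → x ≡ proj₁ e) (elements p)
∈-elements (inside ∷ p)  here       = here refl
∈-elements (inside ∷ p)  (there x∈) = there (Anyₚ.map⁺ (Any.map (cong suc) (∈-elements p x∈)))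
∈-elements (outside ∷ p) (there x∈) = Anyₚ.map⁺ (Any.map (cong suc) (∈-elements p x∈))

module _ {n : ℕ} (G : Graph n) where
  module _ (U : Subset n) where

    Packing : Subset n → Set
    Packing M = ∀ {x y} → x ∈ M → y ∈ M → x ≢ y → ¬ ∃ λ c → c ∈ U × Cl G c x × Cl G c y

    Dominates : Subset n → Subset n → Set
    Dominates D A = ∀ {v} → v ∈ A → ∃ λ t → t ∈ D × Cl G v t

    dominated? : ∀ D v → Dec (∃ λ t → t ∈ D × Cl G v t)
    dominated? D v = any? (λ t → (t ∈? D) ×-dec cl? G v t)

    dominates-all : ∀ {D A e} → Dominates D (A - e) → (∃ λ t → t ∈ D × Cl G e t) → Dominates D A
    dominates-all {e = e} dom domₑ {v} v∈A with v ≟ e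
    ... | yes refl = domₑ
    ... | no v≢e   = dom (x∈p∧x≢y⇒x∈p-y v∈A v≢e)

    module _ {S T A : Subset n} {c e f : Fin n}
             (e∈A : e ∈ A) (f∈A : f ∈ A) (e≢f : e ≢ f) (c~e : Cl G c e) (c~f : Cl G c f)
             (domS : Dominates S (A - e)) (domT : Dominates T (A - f))
             (¬domS : ¬ ∃ λ t → t ∈ S × Cl G e t) (¬domT : ¬ ∃ λ t → t ∈ T × Cl G f t) where

      private
        W : Subset n
        W = contested S T ⁅ c ⁆

        inS : ∀ {x} → x ∈ S → x ∉ T → x ∈ W
        inS x∈ x∉ = x∈p∪q⁺ (inj₁ (x∈p∪q⁺ (inj₁ (x∈p∧x∉q⇒x∈p─q x∈ x∉))))

        inT : ∀ {x} → x ∈ T → x ∉ S → x ∈ W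
        inT x∈ x∉ = x∈p∪q⁺ (inj₁ (x∈p∪q⁺ (inj₂ (x∈p∧x∉q⇒x∈p─q x∈ x∉))))

        c∈W : c ∈ W
        c∈W = x∈p∪q⁺ (inj₂ (x∈⁅x⁆ c))

      -- A vertex other than `e` and `f` has a dominator in each of `S` and `T`; if neither is
      -- common to both sets, they are two contested vertices, and one near the vertex lies in `C`.
      -- For `e` the two contested vertices are `c` and its dominator in `T`, which differ because
      -- `c` is close to `f` and `T` misses `f`; `f` is symmetric.
      merge-dominates : ∀ C → (∀ v y z → y ∈ W → z ∈ W → y ≢ z → Cl G v y → Cl G v z →
        ∃ λ x → x ∈ W × Cl G v x × x ∈ C) → Dominates (merge S T ⁅ c ⁆ C) A
      merge-dominates C bi {v} v∈A with v ≟ e | v ≟ f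
      ... | yes refl | yes refl = contradiction refl e≢f
      ... | yes refl | no _ with domT (x∈p∧x≢y⇒x∈p-y e∈A e≢f)
      ...   | t , t∈T , v~t with bi v c t c∈W (inT t∈T λ t∈S → ¬domS (t , t∈S , v~t))
                                  (λ { refl → ¬domT (c , t∈T , cl-sym G c~f) }) (cl-sym G c~e) v~t
      ...     | x , x∈W , v~x , x∈C = x , x∈p∪q⁺ (inj₂ (x∈p∩q⁺ (x∈W , x∈C))) , v~x
      merge-dominates C bi {v} v∈A | no _ | yes refl with domS (x∈p∧x≢y⇒x∈p-y f∈A (e≢f ∘ sym))
      ...   | t , t∈S , v~t with bi v c t c∈W (inS t∈S λ t∈T → ¬domT (t , t∈T , v~t))
                                  (λ { refl → ¬domS (c , t∈S , cl-sym G c~e) }) (cl-sym G c~f) v~t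
      ...     | x , x∈W , v~x , x∈C = x , x∈p∪q⁺ (inj₂ (x∈p∩q⁺ (x∈W , x∈C))) , v~x
      merge-dominates C bi {v} v∈A | no v≢e | no v≢f
        with domS (x∈p∧x≢y⇒x∈p-y v∈A v≢e) | domT (x∈p∧x≢y⇒x∈p-y v∈A v≢f)
      ... | s , s∈S , v~s | t , t∈T , v~t with s ∈? T | t ∈? S
      ...   | yes s∈T | _ = s , x∈p∪q⁺ (inj₁ (x∈p∩q⁺ (s∈S , s∈T))) , v~s
      ...   | no _ | yes t∈S = t , x∈p∪q⁺ (inj₁ (x∈p∩q⁺ (t∈S , t∈T))) , v~t
      ...   | no s∉T | no t∉S with bi v s t (inS s∈S s∉T) (inT t∈T t∉S) (λ { refl → s∉T t∈T }) v~s v~t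
      ...     | x , x∈W , v~x , x∈C = x , x∈p∪q⁺ (inj₂ (x∈p∩q⁺ (x∈W , x∈C))) , v~x

    merge-⊆ : ∀ {S T c} C → S ⊆ U → T ⊆ U → c ∈ U → merge S T ⁅ c ⁆ C ⊆ U
    merge-⊆ {S} {T} {c} C S⊆ T⊆ c∈ x∈ with x∈p∪q⁻ (S ∩ T) _ x∈
    ... | inj₁ x∈∩ = S⊆ (p∩q⊆p S T x∈∩)
    ... | inj₂ x∈∩ with x∈p∪q⁻ ((S ─ T) ∪ (T ─ S)) ⁅ c ⁆ (p∩q⊆p (contested S T ⁅ c ⁆) C x∈∩)
    ...   | inj₂ x∈c = subst (_∈ U) (sym (x∈⁅y⁆⇒x≡y c x∈c)) c∈
    ...   | inj₁ x∈Δ with x∈p∪q⁻ (S ─ T) (T ─ S) x∈Δ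
    ...     | inj₁ x∈S = S⊆ (p─q⊆p S T x∈S)
    ...     | inj₂ x∈T = T⊆ (p─q⊆p T S x∈T)

    -- The packing is confined to `A`, while dominators may come from all of `U`; this lets `A`
    -- shrink while the graph stays fixed.
    Duality : Subset n → Set
    Duality A = ∃₂ λ M D → M ⊆ A × Packing M × D ⊆ U × Dominates D A × ∣ D ∣ ≤ ∣ M ∣

    module _ (colour : ∀ W → ∃ (Bicoloured G W)) where

      -- If `D₁` happens to dominate `e`, or `D₂` to dominate `f`, the smaller solution already
      -- serves. Otherwise both colour classes give dominating merges, and one of them is small
      -- enough.
      merge-duality : ∀ {A c e f} → e ∈ A → f ∈ A → e ≢ f → c ∈ U → Cl G c e → Cl G c f →
        Duality (A - e) → Duality (A - f) → Duality A
      merge-duality {A} {c} {e} {f} e∈A f∈A e≢f c∈U c~e c~f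
        (M₁ , D₁ , M₁⊆ , pack₁ , D₁⊆ , dom₁ , ≤₁) (M₂ , D₂ , M₂⊆ , pack₂ , D₂⊆ , dom₂ , ≤₂)
        with dominated? D₁ e | dominated? D₂ f
      ... | yes d | _ = M₁ , D₁ , p─q⊆p A _ ∘ M₁⊆ , pack₁ , D₁⊆ , dominates-all dom₁ d , ≤₁
      ... | no _ | yes d = M₂ , D₂ , p─q⊆p A _ ∘ M₂⊆ , pack₂ , D₂⊆ , dominates-all dom₂ d , ≤₂
      ... | no ¬d₁ | no ¬d₂ with colour (contested D₁ D₂ ⁅ c ⁆)
      ...   | g , bi = result
        where
        g? : Decidable (λ v → g v ≡ true)
        g? v = g v ≟ᵇ true
        C = comprehension g?
        dom : ∀ b C → (∀ {v} → g v ≡ b → v ∈ C) → Dominates (merge D₁ D₂ ⁅ c ⁆ C) A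
        dom b C ∈C = merge-dominates e∈A f∈A e≢f c~e c~f dom₁ dom₂ ¬d₁ ¬d₂ C λ v y z y∈ z∈ ne v~y v~z →
          let x , x∈ , v~x , gx = bi v y z y∈ z∈ ne v~y v~z b in x , x∈ , v~x , ∈C gx
        domC : Dominates (merge D₁ D₂ ⁅ c ⁆ C) A
        domC = dom true C (∈-comprehension⁺ g?)
        dom∁ : Dominates (merge D₁ D₂ ⁅ c ⁆ (∁ C)) A
        dom∁ = dom false (∁ C) λ gv → x∉p⇒x∈∁p λ v∈C →
          contradiction (trans (sym gv) (∈-comprehension⁻ g? v∈C)) (λ ())
        choose : ∀ M → M ⊆ A → Packing M → ∣ D₁ ∣ ≤ ∣ M ∣ → ∣ D₂ ∣ ≤ ∣ M ∣ → Duality A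
        choose M M⊆ pack l₁ l₂
          with smaller-half ∣ M ∣ (≤-trans (merge-card D₁ D₂ ⁅ c ⁆ C)
                 (+-mono-≤ l₁ (+-mono-≤ l₂ (≤-reflexive (∣⁅x⁆∣≡1 c)))))
        ... | inj₁ l = M , _ , M⊆ , pack , merge-⊆ C D₁⊆ D₂⊆ c∈U , domC , l
        ... | inj₂ l = M , _ , M⊆ , pack , merge-⊆ (∁ C) D₁⊆ D₂⊆ c∈U , dom∁ , l
        result : Duality A
        -- The larger packing bounds both dominating sets.
        result with ≤-total ∣ M₁ ∣ ∣ M₂ ∣
        ... | inj₁ l = choose M₂ (p─q⊆p A _ ∘ M₂⊆) pack₂ (≤-trans ≤₁ l) ≤₂
        ... | inj₂ l = choose M₁ (p─q⊆p A _ ∘ M₁⊆) pack₁ ≤₁ (≤-trans ≤₂ l)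

      duality : ∀ k A → ∣ A ∣ ≤ k → A ⊆ U → Duality A
      duality k A ≤k A⊆U
        with any? (λ e → any? (λ f → any? (λ c → (e ∈? A) ×-dec (f ∈? A) ×-dec ¬? (e ≟ f) ×-dec
                   (c ∈? U) ×-dec cl? G c e ×-dec cl? G c f)))
      -- With no shared neighbour left, `A` is a packing and dominates itself.
      ... | no none = A , A , (λ x∈ → x∈) ,
              (λ x∈ y∈ x≢y (c , c∈ , d , d′) → none (_ , _ , c , x∈ , y∈ , x≢y , c∈ , d , d′)) ,
              A⊆U , (λ v∈ → _ , v∈ , inj₁ refl) , ≤-refl
      duality zero A ≤k A⊆U | yes (e , f , c , e∈A , _) =
        contradiction (<-≤-trans (x∈p⇒∣p-x∣<∣p∣ e∈A) ≤k) (λ ())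
      duality (suc k) A ≤k A⊆U | yes (e , f , c , e∈A , f∈A , e≢f , c∈U , c~e , c~f) =
        merge-duality e∈A f∈A e≢f c∈U c~e c~f (smaller e∈A) (smaller f∈A)
        where
        smaller : ∀ {x} → x ∈ A → Duality (A - x)
        smaller x∈ = duality k _ (≤-pred (<-≤-trans (x∈p⇒∣p-x∣<∣p∣ x∈) ≤k)) (A⊆U ∘ p─q⊆p A _)

    -- Stars as parts of closed neighbourhoods

    closedStar : ∀ {c} → c ∈ U → Star G U
    closedStar {c} c∈U = record
      { centre = c ; leaves = comprehension leaf? ; centre∈U = c∈U
      ; leaves⊆U = λ x∈ → proj₁ (∈-comprehension⁻ leaf? x∈)
      ; leavesAdj = λ x∈ → proj₂ (∈-comprehension⁻ leaf? x∈) }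
      where
      leaf? : Decidable (λ x → x ∈ U × Edge G c x)
      leaf? x = (x ∈? U) ×-dec edge? G c x

    cl⇒inStar : ∀ {c x} (c∈U : c ∈ U) → x ∈ U → Cl G c x → InStar G x (closedStar c∈U)
    cl⇒inStar c∈U x∈U (inj₁ e) = inj₁ (sym e)
    cl⇒inStar {c} c∈U x∈U (inj₂ e) = inj₂ (∈-comprehension⁺ (λ x → (x ∈? U) ×-dec edge? G c x) (x∈U , e))

    inStar⇒cl : ∀ {x} (s : Star G U) → InStar G x s → Cl G (Star.centre s) x
    inStar⇒cl s (inj₁ e)  = inj₁ (sym e)
    inStar⇒cl s (inj₂ x∈) = inj₂ (Star.leavesAdj s x∈)

    inStar? : ∀ x (s : Star G U) → Dec (InStar G x s)
    inStar? x s = (x ≟ Star.centre s) ⊎-dec (x ∈? Star.leaves s)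

    packing⇒independent : ∀ {M} → M ⊆ U → Packing M → IsSIndependent G U M
    packing⇒independent M⊆U pack = M⊆U , λ x∈ y∈ x≢y (s , xs , ys) →
      pack x∈ y∈ x≢y (Star.centre s , Star.centre∈U s , inStar⇒cl s xs , inStar⇒cl s ys)

    dominates⇒cover : ∀ {D} → D ⊆ U → Dominates D U → ∃ λ F → IsSCover G U F × length F ≡ ∣ D ∣
    dominates⇒cover {D} D⊆U dom = map toStar (elements D) , cover ,
      trans (length-map toStar (elements D)) (length-elements D)
      where
      toStar : ∃ (_∈ D) → Star G U
      toStar (c , c∈) = closedStar (D⊆U c∈)
      cover : IsSCover G U (map toStar (elements D))
      cover x∈U with dom x∈U
      ... | t , t∈D , x~t = Anyₚ.map⁺ (Any.map
              (λ { {c , c∈} refl → cl⇒inStar (D⊆U c∈) x∈U (cl-sym G x~t) }) (∈-elements D t∈D))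

    independent≤cover : ∀ {T F} → IsSIndependent G U T → IsSCover G U F → ∣ T ∣ ≤ length F
    independent≤cover {T} {F} (T⊆U , ind) cov = subst (∣ T ∣ ≤_) (*-identityʳ (length F))
      -- Membership in `T` is built into the relation because the capacity bound concerns arbitrary
      -- sets `P`. The capacity is 1, as a star meets an independent set at most once.
      (cover-bound (λ x s → x ∈ T × InStar G x s) (λ x s → (x ∈? T) ×-dec inStar? x s) 1
        (λ s P P⊆ → ∣p∣≤1 P λ {x} {y} x∈ y∈ → decidable-stable (x ≟ y) λ ne →
          ind (proj₁ (P⊆ x∈)) (proj₁ (P⊆ y∈)) ne (s , proj₂ (P⊆ x∈) , proj₂ (P⊆ y∈)))
        F T (λ x∈ → Any.map (x∈ ,_) (cov (T⊆U x∈))))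

  noOddSun⇒perfect : Triangulated G → ¬ ContainsOddSun G → SPerfect G
  noOddSun⇒perfect tri no-sun U
    with duality U (λ W → bicolouring G tri no-sun ∣ W ∣ W ≤-refl) ∣ U ∣ U ≤-refl (λ x∈ → x∈)
  ... | M , D , M⊆U , pack , D⊆U , dom , D≤M with dominates⇒cover U D⊆U dom
  ...   | F , cov , len = ∣ M ∣ ,
          ((M , ind , refl) , λ T T-ind → ≤-trans (independent≤cover U T-ind cov) F≤M) ,
          ((F , cov , ≤-antisym F≤M (independent≤cover U ind cov)) , λ F′ cov′ → independent≤cover U ind cov′)
    where
    ind : IsSIndependent G U M
    ind = packing⇒independent U M⊆U pack
    F≤M : length F ≤ ∣ M ∣
    F≤M = subst (_≤ ∣ M ∣) (sym len) D≤M

  -- Odd suns violate S-perfection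

  module _ {m : ℕ} {v u : Fin (suc m) → Fin n} (sun : IsInducedSun G m v u) (2≤m : 2 ≤ m) where

    private
      u-injective : ∀ {i j} → u i ≡ u j → i ≡ j
      u-injective = proj₁ (proj₂ sun)
      v≢u : ∀ i j → v i ≢ u j
      v≢u = proj₁ (proj₂ (proj₂ sun))
      v-edge : ∀ i → Edge G (v i) (v (next i))
      v-edge = proj₁ (proj₂ (proj₂ (proj₂ sun)))
      uv : ∀ i j → (Edge G (u i) (v j) → j ≡ i ⊎ j ≡ next i) × (j ≡ i ⊎ j ≡ next i → Edge G (u i) (v j))
      uv = proj₁ (proj₂ (proj₂ (proj₂ (proj₂ sun))))
      u-nonEdge : ∀ i j → NonEdge G (u i) (u j)
      u-nonEdge = proj₂ (proj₂ (proj₂ (proj₂ (proj₂ sun))))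

      onSun? : Decidable (λ x → ∃ λ i → x ≡ v i ⊎ x ≡ u i)
      onSun? x = any? (λ i → (x ≟ v i) ⊎-dec (x ≟ u i))

      sunVertices : Subset n
      sunVertices = comprehension onSun?

      v∈ : ∀ i → v i ∈ sunVertices
      v∈ i = ∈-comprehension⁺ onSun? (i , inj₁ refl)

      u∈ : ∀ i → u i ∈ sunVertices
      u∈ i = ∈-comprehension⁺ onSun? (i , inj₂ refl)

      -- Two of the three alternatives are of the same kind, and `next` is injective.
      two-of-three : ∀ {x i j k : Fin (suc m)} → x ≡ i ⊎ x ≡ next i → x ≡ j ⊎ x ≡ next j →
        x ≡ k ⊎ x ≡ next k →
        i ≡ j ⊎ i ≡ k ⊎ j ≡ k
      two-of-three (inj₁ e) (inj₁ f) _        = inj₁ (trans (sym e) f)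
      two-of-three (inj₁ e) (inj₂ _) (inj₁ g) = inj₂ (inj₁ (trans (sym e) g))
      two-of-three (inj₁ _) (inj₂ f) (inj₂ g) = inj₂ (inj₂ (next-injective _ _ (trans (sym f) g)))
      two-of-three (inj₂ e) (inj₂ f) _        = inj₁ (next-injective _ _ (trans (sym e) f))
      two-of-three (inj₂ e) (inj₁ _) (inj₂ g) = inj₂ (inj₁ (next-injective _ _ (trans (sym e) g)))
      two-of-three (inj₂ _) (inj₁ f) (inj₁ g) = inj₂ (inj₂ (trans (sym f) g))

    -- A centre `v a` reaches only `u a` and the `u` before it; a centre `u a` reaches no other `u`.
    star-capacity : ∀ (s : Star G sunVertices) P → (∀ {i} → i ∈ P → InStar G (u i) s) → ∣ P ∣ ≤ 2
    star-capacity s P P⊆ with ∈-comprehension⁻ onSun? (Star.centre∈U s)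
    ... | a , inj₁ e = ∣p∣≤2 P λ i∈ j∈ k∈ → two-of-three (touch i∈) (touch j∈) (touch k∈)
      where
      touch : ∀ {i} → i ∈ P → a ≡ i ⊎ a ≡ next i
      touch {i} i∈ = proj₁ (uv i a) (edge-sym G (cl-edge G (v≢u a i)
        (subst (λ c → Cl G c (u i)) e (inStar⇒cl sunVertices s (P⊆ i∈)))))
    ... | a , inj₂ e = ∣p∣≤2 P λ i∈ j∈ _ → inj₁ (trans (sym (touch i∈)) (touch j∈))
      where
      touch : ∀ {i} → i ∈ P → a ≡ i
      touch {i} i∈ with subst (λ c → Cl G c (u i)) e (inStar⇒cl sunVertices s (P⊆ i∈))
      ... | inj₁ f = u-injective f
      ... | inj₂ f = contradiction (trans (sym f) (u-nonEdge a i)) (λ ())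

    cover-≥ : ∀ {F} → IsSCover G sunVertices F → suc m ≤ length F * 2
    cover-≥ {F} cov = subst (_≤ length F * 2) (∣⊤∣≡n (suc m))
      (cover-bound (λ i s → InStar G (u i) s) (λ i → inStar? sunVertices (u i)) 2 star-capacity
        F ⊤ (λ {i} _ → cov (u∈ i)))

    -- Both `v a` and `u a` are close to `v a` and `v (next a)`. No `v i` is close to two members of
    -- `T`, since its closed star would contain both.
    independent-≤ : ∀ {T} → IsSIndependent G sunVertices T → ∣ T ∣ * 2 ≤ suc m
    independent-≤ {T} (T⊆ , ind) = subst (∣ T ∣ * 2 ≤_) (∣⊤∣≡n (suc m))
      (packing-bound (λ t i → Cl G (v i) t) ∣ T ∣ T ⊤ ≤-refl two λ {t} {t′} {i} t∈ t′∈ c c′ →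
        decidable-stable (t ≟ t′) λ ne → ind t∈ t′∈ ne
          (closedStar sunVertices (v∈ i) , cl⇒inStar sunVertices (v∈ i) (T⊆ t∈) c ,
           cl⇒inStar sunVertices (v∈ i) (T⊆ t′∈) c′))
      where
      two : ∀ {t} → t ∈ T → ∃₂ λ i j → i ≢ j × (Cl G (v i) t × i ∈ ⊤) × (Cl G (v j) t × j ∈ ⊤)
      two t∈ with ∈-comprehension⁻ onSun? (T⊆ t∈)
      ... | a , inj₁ refl = a , next a , next-≢ a (<⇒≤ 2≤m) ,
              (inj₁ refl , ∈⊤) , (inj₂ (edge-sym G (v-edge a)) , ∈⊤)
      ... | a , inj₂ refl = a , next a , next-≢ a (<⇒≤ 2≤m) ,
              (inj₂ (edge-sym G (proj₂ (uv a a) (inj₁ refl))) , ∈⊤) ,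
              (inj₂ (edge-sym G (proj₂ (uv a (next a)) (inj₂ refl))) , ∈⊤)

    sun-not-odd : SPerfect G → ¬ Odd (suc m)
    sun-not-odd perfect k-odd with perfect sunVertices
    ... | k , ((T , ind , refl) , _) , ((F , cov , len) , _) = ¬odd-double ∣ T ∣
            (subst Odd (≤-antisym (subst (λ l → suc m ≤ l * 2) len (cover-≥ cov)) (independent-≤ ind)) k-odd)

  perfect⇒noOddSun : SPerfect G → ¬ ContainsOddSun G
  perfect⇒noOddSun perfect (m , m-odd , s≤s 2≤m , v , u , sun) = sun-not-odd sun 2≤m perfect m-odd

theorem2p2 : ∀ {n : ℕ} (G : Graph n) → Triangulated G →
    (SPerfect G → ¬ ContainsOddSun G) × (¬ ContainsOddSun G → SPerfect G)
theorem2p2 G tri = perfect⇒noOddSun G , noOddSun⇒perfect G tri
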